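{- Let $\vec S$ be a submodular separation system without degenerate elements in a distributive universe $\vec U$ of separations. Then exactly one of the following holds: (i) $S$ has an abstract tangle. (ii) There exists an $S$-tree over $\mathcal T^*$ (witnessing that $S$ has no abstract tangle).
   Context: A separation system $(\vec S,\le,{}^*)$ is a partially ordered set with an order-reversing involution $^*:\vec S\to\vec S$. Its elements are called oriented separations. An (unoriented) separation is a set $s=\{\vec s,\vec s^{\,*}\}$; $S$ denotes the set of all these. $\vec s$ is degenerate if $\vec s=\vec s^{\,*}$. A universe of separations is a separation system $\vec U$ whose partial order is a lattice (join $\vee$, meet $\wedge$); it is distributive if this lattice is distributive. A separation system $\vec S$ in $\vec U$ is a subset of $\vec U$ closed under $^*$, with the induced order and involution. It is submodular if for all $\vec s,\vec t\in\vec S$ at least one of $\vec s\vee\vec t$, $\vec s\wedge\vec t$ (computed in $\vec U$) lies in $\vec S$. $\vec x\in\vec U$ is co-small if $\vec x^{\,*}\le\vec x$. An orientation of $S$ is a set $O\subseteq\vec S$ containing exactly one of $\vec s,\vec s^{\,*}$ for every $s\in S$. It is consistent if whenever $r,s\in S$ are distinct with orientations $\vec r\le\vec s\in O$, then $\vec r^{\,*}\notin O$. Let $\mathcal T$ be the set of all sets $\{\vec r,\vec s,\vec t\}\subseteq\vec U$ ($\vec r,\vec s,\vec t$ not necessarily distinct) such that $\vec r\vee\vec s\vee\vec t$ is co-small. An abstract tangle of $S$ is a consistent orientation $O$ of $S$ such that no subset of $O$ is an element of $\mathcal T$. A star is a set $\sigma$ of non-degenerate oriented separations such that $\vec s\le\vec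 t^{\,*}$ for any two distinct $\vec s,\vec t\in\sigma$; $\mathcal T^*$ is the set of all elements of $\mathcal T$ that are stars. An $S$-tree is a pair $(T,\alpha)$ of a tree $T$ and a map $\alpha$ from the set $\vec E(T)=\{(x,y): xy\in E(T)\}$ of orientations of edges of $T$ to $\vec S$ such that $\alpha(y,x)=\alpha(x,y)^*$ for all $xy\in E(T)$. For $\mathcal F\subseteq 2^{\vec U}$ it is an $S$-tree over $\mathcal F$ if $\alpha(F_t)\in\mathcal F$ for every node $t$ of $T$, where $F_t=\{(s,t): st\in E(T)\}$. -}

module Defs where

open import Level using (Level; 0ℓ) renaming (suc to lsuc)
open import Data.Bool.Base using (Bool; T)
open import Data.Fin.Base using (Fin; zero; suc; inject₁; fromℕ)
open import Data.Nat.Base using (ℕ; _+_)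
open import Data.Product using (Σ; ∃; ∃-syntax; ∃!; _×_)
open import Data.Sum.Base using (_⊎_)
open import Function.Definitions using (Injective)
open import Relation.Binary.Core using (Rel)
open import Relation.Binary.Construct.Closure.ReflexiveTransitive using (Star)
open import Relation.Binary.Lattice.Structures using (IsLattice)
open import Relation.Binary.PropositionalEquality using (_≡_; _≢_)
open import Relation.Nullary using (¬_)
open import Relation.Unary
  using (Pred; _∈_; _∉_; _⊆_; _≐_; _∩_; _∪_; ｛_｝)
import Algebra.Definitions as AlgDefs

private
  variable
    ℓ : Level

record Universe (ℓ : Level) : Set (lsuc ℓ) where
  infix  8 _*
  infixl 6 _∨_ _∧_
  infix  4 _≤_
  field
    Carrier      : Set ℓ
    _≤_          : Rel Carrier ℓ
    _∨_ _∧_      : Carrier → Carrier → Carrier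
    _*           : Carrier → Carrier
    isLattice    : IsLattice _≡_ _≤_ _∨_ _∧_
    *-antitone   : ∀ {s t} → s ≤ t → t * ≤ s *
    *-involutive : ∀ s → (s *) * ≡ s

  Degenerate : Pred Carrier ℓ
  Degenerate s = s ≡ s *

  CoSmall : Pred Carrier ℓ
  CoSmall s = s * ≤ s

  -- The unoriented separation underlying s.
  sep : Carrier → Pred Carrier ℓ
  sep s = ｛ s ｝ ∪ ｛ s * ｝

Distributive : Universe ℓ → Set ℓ
Distributive U = _∧_ DistributesOver _∨_
  where
  open Universe U
  open AlgDefs {A = Carrier} _≡_ using (_DistributesOver_)

record SeparationSystem (U : Universe ℓ) : Set (lsuc ℓ) where
  open Universe U
  field
    Member   : Pred Carrier ℓ
    *-closed : ∀ {s} → s ∈ Member → s * ∈ Member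

-- Trees are finite: along a double ray with all edges of one direction mapped
-- to s every node gets the star {s, s *}, so infinite trees would break duality.
-- edge? is Bool-valued so that adjacency is proof-irrelevant.
record Graph : Set where
  field
    order  : ℕ
    edge?  : Fin order → Fin order → Bool

  V : Set
  V = Fin order

  Adj : Rel V 0ℓ
  Adj x y = T (edge? x y)

  field
    symmetric   : ∀ x y → Adj x y → Adj y x
    irreflexive : ∀ x → ¬ Adj x x

module _ (G : Graph) where
  open Graph G

  -- A cycle c₀ c₁ … c₍ₖ₊₂₎ c₀ with pairwise distinct vertices.
  IsCycle : (k : ℕ) → (Fin (3 + k) → V) → Set
  IsCycle k c = Injective _≡_ _≡_ c
              × (∀ i → Adj (c (inject₁ i)) (c (suc i)))
              × Adj (c (fromℕ (2 + k))) (c zero)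

  record IsTree : Set where
    field
      nonEmpty  : V
      connected : ∀ x y → Star Adj x y
      acyclic   : ∀ k c → ¬ IsCycle k c

module _ (U : Universe ℓ) where
  open Universe U

  -- Predicates stand for sets, with ≐ as equality.
  𝒯 : Pred (Pred Carrier ℓ) ℓ
  𝒯 σ = ∃[ r ] ∃[ s ] ∃[ t ]
    (σ ≐ ｛ r ｝ ∪ ｛ s ｝ ∪ ｛ t ｝) × CoSmall (r ∨ s ∨ t)

  IsStar : Pred (Pred Carrier ℓ) ℓ
  IsStar σ = (∀ {s} → s ∈ σ → ¬ Degenerate s)
           × (∀ {s t} → s ∈ σ → t ∈ σ → s ≢ t → s ≤ t *)

  𝒯* : Pred (Pred Carrier ℓ) ℓ
  𝒯* = 𝒯 ∩ IsStar

module _ {U : Universe ℓ} (S : SeparationSystem U) where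
  open Universe U
  open SeparationSystem S

  NoDegenerateElements : Set ℓ
  NoDegenerateElements = ∀ {s} → s ∈ Member → ¬ Degenerate s

  Submodular : Set ℓ
  Submodular = ∀ {s t} → s ∈ Member → t ∈ Member →
               (s ∨ t ∈ Member) ⊎ (s ∧ t ∈ Member)

  -- ∃! asks for one element of the set {s, s *}, so a degenerate s has exactly
  -- one orientation.
  IsOrientation : Pred (Pred Carrier ℓ) ℓ
  IsOrientation O = O ⊆ Member
                  × (∀ {s} → s ∈ Member → ∃! _≡_ (_∈ sep s ∩ O))

  IsConsistent : Pred (Pred Carrier ℓ) ℓ
  IsConsistent O = ∀ {r s} → r ∈ Member → s ∈ Member →
                   ¬ (sep r ≐ sep s) → r ≤ s → s ∈ O → r * ∉ O

  record IsAbstractTangle (O : Pred Carrier ℓ) : Set (lsuc ℓ) where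
    field
      isOrientation : IsOrientation O
      isConsistent  : IsConsistent O
      avoids-𝒯      : ∀ (σ : Pred Carrier ℓ) → σ ⊆ O → σ ∉ 𝒯 U

  HasAbstractTangle : Set (lsuc ℓ)
  HasAbstractTangle = ∃ IsAbstractTangle

  record STree : Set ℓ where
    field
      tree   : Graph
      isTree : IsTree tree
    open Graph tree public
    field
      α        : (x y : V) → Adj x y → Carrier
      α-Member : ∀ x y (e : Adj x y) → α x y e ∈ Member
      α-*      : ∀ x y (e : Adj x y) (e′ : Adj y x) →
                 α y x e′ ≡ α x y e *

    -- α(F_t), the image of the set of edges oriented towards t.
    α[F_] : V → Pred Carrier ℓ
    α[F t ] u = ∃[ s ] Σ (Adj s t) λ e → α s t e ≡ u

  STreeOver : Pred (Pred Carrier ℓ) ℓ → Set ℓ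
  STreeOver ℱ = Σ STree λ τ → let open STree τ in ∀ t → α[F t ] ∈ ℱ

-- A refutation is an S-tree over 𝒯* whose leaves may also carry separations
-- from a given down-closed set A.  By Zorn's lemma there is a maximal irrefutable
-- A; if it orients S, it is a tangle, since any triple in A with co-small join
-- can be uncrossed into a star below it.  That it orients S means: if A ∪ ↓s and
-- A ∪ ↓s* are refutable, so is A.  As U is distributive, both refutations live
-- in a finite sublattice.  There, take x ≤ s and y ≤ s* minimal outside A.  By
-- induction A ∪ {x} and A ∪ {y} are refutable, by trees rerooted at leaves x and y.
-- Submodularity yields a separation between x and y* onto which both trees can
-- be shifted, and there they are glued together.
-- Conversely, a tangle orients the edges of a finite tree, and the star at a sink
-- of this orientation would be contained in the tangle.

module Submission where

open import Defs
open import Axiom.ExcludedMiddle using (ExcludedMiddle)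
open import Axiom.Extensionality.Propositional using (Extensionality; lower-extensionality)
open import Data.Bool.Base using (Bool; true; false; T)
open import Data.Empty using (⊥; ⊥-elim)
open import Data.Fin.Base using (Fin; zero; suc; inject₁; fromℕ; toℕ)
open import Data.Fin.Properties
  using (toℕ-inject₁; toℕ-fromℕ; toℕ-injective; toℕ<n; pigeonhole; +↔⊎; 1↔⊤)
open import Data.Fin.Relation.Unary.Top using (view; ‵fromℕ; ‵inj₁)
open import Data.List.Base using (List; []; _∷_; _++_; filter; length; cartesianProductWith)
open import Data.List.Membership.Propositional using () renaming (_∈_ to _∈ˡ_)
open import Data.List.Membership.Propositional.Properties
  using (∈-filter⁺; ∈-++⁺ˡ; ∈-++⁺ʳ; ∈-cartesianProductWith⁺; ∈-cartesianProductWith⁻)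
open import Data.List.Properties using (filter-notAll)
open import Data.List.Relation.Unary.Any using (here; there)
import Data.List.Relation.Unary.Any as Any
open import Data.Maybe.Base using (Maybe; just; nothing)
open import Data.Nat.Base as ℕ using (ℕ; zero; suc; z≤n; s≤s)
import Data.Nat.Properties as ℕₚ
open import Data.Nat.GeneralisedArithmetic using (fold; fold-+)
open import Data.Nat.Induction using (<-rec)
open import Data.Product using (Σ; ∃; ∃-syntax; _×_; _,_; proj₁; proj₂)
open import Data.Sum using (_⊎_; inj₁; inj₂; [_,_]′)
open import Data.Sum.Function.Propositional using (_⊎-↔_)
open import Data.Unit.Base using (⊤; tt)
open import Function.Construct.Composition using (_↔-∘_)
open import Function using (_∘_; id; _↔_; Inverse)
open import Level using (Level; Lift; lift; lower)
open import Relation.Binary.Core using (Rel)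
open import Relation.Binary.Construct.Closure.ReflexiveTransitive using (Star; ε; _◅_; _◅◅_)
import Relation.Binary.Construct.Closure.ReflexiveTransitive as Star
open import Relation.Binary.Definitions using (tri<; tri≈; tri>)
open import Relation.Binary.Lattice using (IsLattice; DistributiveLattice)
import Relation.Binary.Lattice.Properties.DistributiveLattice as DistributiveLatticeProperties
import Relation.Binary.Lattice.Properties.JoinSemilattice as JoinProperties
import Relation.Binary.Lattice.Properties.MeetSemilattice as MeetProperties
import Relation.Binary.Lattice.Properties.Lattice as LatticeProperties
open import Relation.Binary.PropositionalEquality
  using (_≡_; _≢_; refl; sym; trans; cong; subst; subst₂)
open import Relation.Binary.Structures using (IsPartialOrder)
open import Relation.Nullary using (¬_; Dec; yes; no; contradiction)
open import Relation.Nullary.Decidable using (isYes; toWitness; fromWitness; ¬?)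
open import Relation.Unary using (Pred; _∈_; _⊆_; _≐_; _∩_; _∪_; ｛_｝)

private
  variable
    ℓ : Level

-- The candidate is replaced only by an element below it, so transitivity keeps it minimal among
-- those already seen. The order is a parameter because maximal elements come from the dual order.
minimal : {A : Set ℓ} {_≼_ : Rel A ℓ} → IsPartialOrder _≡_ _≼_ → ExcludedMiddle ℓ →
          (P : Pred A ℓ) (xs : List A) → ∀ {x} → x ∈ˡ xs → P x →
          ∃[ m ] P m × (∀ {y} → y ∈ˡ xs → P y → y ≼ m → y ≡ m)
minimal {A = A} {_≼_} po em P xs x∈xs Px =
  [ (λ none → ⊥-elim (none x∈xs Px)) , id ]′ (go xs)
  where
  module PO = IsPartialOrder po

  go : ∀ xs → (∀ {y} → y ∈ˡ xs → ¬ P y) ⊎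
              ∃[ m ] P m × (∀ {y} → y ∈ˡ xs → P y → y ≼ m → y ≡ m)
  go [] = inj₁ λ ()
  go (x ∷ xs) with go xs | em {P x}
  ... | inj₁ none | no ¬Px = inj₁ λ { (here refl) → ¬Px ; (there y∈) → none y∈ }
  ... | inj₁ none | yes Px = inj₂ (x , Px , λ
    { (here refl) _ _ → refl ; (there y∈) Py _ → ⊥-elim (none y∈ Py) })
  ... | inj₂ (m , Pm , min) | no ¬Px = inj₂ (m , Pm , λ
    { (here refl) Px _ → ⊥-elim (¬Px Px) ; (there y∈) → min y∈ })
  ... | inj₂ (m , Pm , min) | yes Px with em {x ≼ m}
  ... | no x⋠m = inj₂ (m , Pm , λ
    { (here refl) _ x≼m → ⊥-elim (x⋠m x≼m) ; (there y∈) → min y∈ })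
  ... | yes x≼m = inj₂ (x , Px , λ
    { (here refl) _ _ → refl
    ; (there y∈) Py y≼x → PO.antisym y≼x
        (subst (x ≼_) (sym (min y∈ Py (PO.trans y≼x x≼m))) x≼m) })

-- Order, involution and co-smallness in a distributive universe

module DistributiveUniverse (U : Universe ℓ) (distributive : Distributive U) where
  open Universe U public
  open IsLattice isLattice public
    using (isPartialOrder; x≤x∨y; y≤x∨y; ∨-least; x∧y≤x; x∧y≤y; ∧-greatest)
    renaming (refl to ≤-refl; trans to ≤-trans; antisym to ≤-antisym; reflexive to ≤-reflexive)

  distributiveLattice : DistributiveLattice ℓ ℓ ℓ
  distributiveLattice = record
    { isDistributiveLattice = record
      { isLattice = isLattice ; ∧-distribˡ-∨ = proj₁ distributive } }

  open DistributiveLattice distributiveLattice public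
    using (joinSemilattice; meetSemilattice; lattice; ∧-distribˡ-∨)
  open DistributiveLatticeProperties distributiveLattice public using (∧-distribʳ-∨)
  open JoinProperties joinSemilattice public using (∨-monotonic; ∨-comm; x≤y⇒x∨y≈y)
  open MeetProperties meetSemilattice public using (∧-monotonic; ∧-comm; y≤x⇒x∧y≈y)
  open LatticeProperties lattice public using (∨-absorbs-∧; ∧-∨-isLattice)

  *-swapʳ : ∀ {x y} → x ≤ y * → y ≤ x *
  *-swapʳ x≤y* = subst (_≤ _) (*-involutive _) (*-antitone x≤y*)

  *-swapˡ : ∀ {x y} → x * ≤ y → y * ≤ x
  *-swapˡ x*≤y = subst (_ ≤_) (*-involutive _) (*-antitone x*≤y)

  ∧-* : ∀ x y → (x ∧ y) * ≡ x * ∨ y *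
  ∧-* x y = ≤-antisym
    (*-swapˡ (∧-greatest (*-swapˡ (x≤x∨y _ _)) (*-swapˡ (y≤x∨y _ _))))
    (∨-least (*-antitone (x∧y≤x _ _)) (*-antitone (x∧y≤y _ _)))

  ∨-* : ∀ x y → (x ∨ y) * ≡ x * ∧ y *
  ∨-* x y = ≤-antisym
    (∧-greatest (*-antitone (x≤x∨y _ _)) (*-antitone (y≤x∨y _ _)))
    (*-swapʳ (∨-least (*-swapʳ (x∧y≤x _ _)) (*-swapʳ (x∧y≤y _ _))))

  ∨-least₃ : ∀ {a b c v} → a ≤ v → b ≤ v → c ≤ v → a ∨ b ∨ c ≤ v
  ∨-least₃ a≤v b≤v c≤v = ∨-least (∨-least a≤v b≤v) c≤v

  in₁ : ∀ {a b c} → a ≤ a ∨ b ∨ c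
  in₁ = ≤-trans (x≤x∨y _ _) (x≤x∨y _ _)

  in₂ : ∀ {a b c} → b ≤ a ∨ b ∨ c
  in₂ = ≤-trans (y≤x∨y _ _) (x≤x∨y _ _)

  in₃ : ∀ {a b c} → c ≤ a ∨ b ∨ c
  in₃ = y≤x∨y _ _

  CoSmall-mono : ∀ {v w} → v ≤ w → CoSmall v → CoSmall w
  CoSmall-mono v≤w cs = ≤-trans (*-antitone v≤w) (≤-trans cs v≤w)

  CoSmall-rotate : ∀ {a b c} → CoSmall (a ∨ b ∨ c) → CoSmall (b ∨ c ∨ a)
  CoSmall-rotate = CoSmall-mono (∨-least₃ in₃ in₁ in₂)

  -- With v ≥ p *, everything below v * is below p, so only the part of n below
  -- p matters: v * ≤ p ∧ (n * ∨ p *) ≤ (n ∧ p) ∨ p *.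
  CoSmall-restrict : ∀ {n v} p → n ∧ p ≤ v → p * ≤ v → CoSmall n → CoSmall v
  CoSmall-restrict {n} {v} p n∧p≤v p*≤v cs =
    ≤-trans (∧-greatest (*-swapˡ p*≤v)
                        (subst (v * ≤_) (∧-* n p) (*-antitone n∧p≤v)))
      (≤-trans (≤-reflexive (∧-distribˡ-∨ p (n *) (p *)))
        (∨-least (≤-trans (∧-greatest (≤-trans (x∧y≤y _ _) cs) (x∧y≤x _ _)) n∧p≤v)
                 (≤-trans (x∧y≤y _ _) p*≤v)))

  -- Distributivity lets the first hypothesis of `CoSmall-restrict` be checked on each joinand.
  ∨∨-∧-≤ : ∀ {a b c p v} → a ∧ p ≤ v → b ∧ p ≤ v → c ∧ p ≤ v → (a ∨ b ∨ c) ∧ p ≤ v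
  ∨∨-∧-≤ {a} {b} {c} {p} a≤ b≤ c≤ =
    ≤-trans (≤-reflexive (∧-distribʳ-∨ p (a ∨ b) c))
      (∨-least (≤-trans (≤-reflexive (∧-distribʳ-∨ p a b)) (∨-least a≤ b≤)) c≤)

  -- Derivations, refutations and operations on them

  DownClosedIn : Pred Carrier ℓ → Pred Carrier ℓ → Set ℓ
  DownClosedIn M A = ∀ {a b} → A a → M b → b ≤ a → A b

  -- An S-tree over 𝒯* with one edge cut, whose cut edge points out of the tree
  -- with label s and whose other leaves carry separations from A.  The star at
  -- the node below the cut edge is {x, y, s *}.
  data Der (M A : Pred Carrier ℓ) : Pred Carrier ℓ where
    hyp  : ∀ {s} → M s → A s → Der M A s
    leaf : ∀ {s} → M s → s ≤ s * → Der M A s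
    node : ∀ {s x y} → M s → Der M A x → Der M A y →
           x ≤ y * → x ≤ s → y ≤ s → CoSmall (x ∨ y ∨ s *) → Der M A s

  Refutable : Pred Carrier ℓ → Pred Carrier ℓ → Set ℓ
  Refutable M A = ∃[ s ] Der M A s × Der M A (s *)

  Der⇒M : ∀ {M A s} → Der M A s → M s
  Der⇒M (hyp Ms _) = Ms
  Der⇒M (leaf Ms _) = Ms
  Der⇒M (node Ms _ _ _ _ _ _) = Ms

  Der-bind : ∀ {M A B} → (∀ {s} → M s → A s → Der M B s) → Der M A ⊆ Der M B
  Der-bind f (hyp Ms As) = f Ms As
  Der-bind f (leaf Ms s≤s*) = leaf Ms s≤s*
  Der-bind f (node Ms dx dy p q r c) = node Ms (Der-bind f dx) (Der-bind f dy) p q r c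

  Der-mono : ∀ {M A B} → A ⊆ B → Der M A ⊆ Der M B
  Der-mono A⊆B = Der-bind (λ Ms As → hyp Ms (A⊆B As))

  Refutable-mono : ∀ {M A B} → A ⊆ B → Refutable M A → Refutable M B
  Refutable-mono A⊆B (s , d , d*) = s , Der-mono A⊆B d , Der-mono A⊆B d*

  -- A derivation has finitely many hypotheses, so at each node the larger of two chain members
  -- serves for both branches. The index `i₀` is the default for `leaf`, which has no hypothesis.
  Der-directed : ∀ {M} {I : Set ℓ} (B : I → Pred Carrier ℓ) →
                 (∀ i j → B i ⊆ B j ⊎ B j ⊆ B i) → I →
                 ∀ {s} → Der M (λ z → ∃[ i ] B i z) s → ∃[ i ] Der M (B i) s
  Der-directed B chain i₀ (hyp Ms (i , Bs)) = i , hyp Ms Bs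
  Der-directed B chain i₀ (leaf Ms s≤s*) = i₀ , leaf Ms s≤s*
  Der-directed B chain i₀ (node Ms dx dy p q r c)
    with Der-directed B chain i₀ dx | Der-directed B chain i₀ dy
  ... | i , dx′ | j , dy′ with chain i j
  ... | inj₁ i⊆j = j , node Ms (Der-mono i⊆j dx′) dy′ p q r c
  ... | inj₂ j⊆i = i , node Ms dx′ (Der-mono j⊆i dy′) p q r c

  -- Cutting the tree at the leaf x instead.  If x occurred at two leaves, it
  -- would lie below its own inverse and hence be derivable outright.
  reroot : ExcludedMiddle ℓ → ∀ {M A x} → (∀ {s} → M s → M (s *)) →
           Refutable M (A ∪ ｛ x ｝) → Refutable M A ⊎ Der M A (x *)
  reroot em {M} {A} {x} closed (s , d , d*) with em {x ≤ x *}
  ... | yes x≤x* = inj₁ (s , discharge d , discharge d*)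
    where
    discharge : Der M (A ∪ ｛ x ｝) ⊆ Der M A
    discharge = Der-bind λ { Ms (inj₁ As) → hyp Ms As ; Ms (inj₂ refl) → leaf Ms x≤x* }
  ... | no x≰x* = combine (context d) (context d*)
    where
    context : ∀ {s} → Der M (A ∪ ｛ x ｝) s →
              Der M A s ⊎ (x ≤ s × (Der M A (s *) → Der M A (x *)))
    context (hyp Ms (inj₁ As)) = inj₁ (hyp Ms As)
    context (hyp Ms (inj₂ refl)) = inj₂ (≤-refl , id)
    context (leaf Ms s≤s*) = inj₁ (leaf Ms s≤s*)
    context (node Ms dy dz y≤z* y≤s z≤s cs) with context dy | context dz
    ... | inj₁ ey | inj₁ ez = inj₁ (node Ms ey ez y≤z* y≤s z≤s cs)
    -- The same star, now cut at `y`: the outgoing label is `y *`, and `z` and `s *` are the two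
    -- branches.
    ... | inj₂ (x≤y , f) | inj₁ ez = inj₂ (≤-trans x≤y y≤s , λ es* → f
      (node (closed (Der⇒M dy)) ez es* (subst (_ ≤_) (sym (*-involutive _)) z≤s)
        (*-swapʳ y≤z*) (*-antitone y≤s)
        (CoSmall-mono (∨-least₃ (≤-trans (≤-reflexive (sym (*-involutive _))) in₃) in₁ in₂) cs)))
    ... | inj₁ ey | inj₂ (x≤z , f) = inj₂ (≤-trans x≤z z≤s , λ es* → f
      (node (closed (Der⇒M dz)) ey es* (subst (_ ≤_) (sym (*-involutive _)) y≤s)
        y≤z* (*-antitone z≤s)
        (CoSmall-mono (∨-least₃ in₁ (≤-trans (≤-reflexive (sym (*-involutive _))) in₃) in₂) cs)))
    ... | inj₂ (x≤y , _) | inj₂ (x≤z , _) =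
      ⊥-elim (x≰x* (≤-trans x≤y (≤-trans y≤z* (*-antitone x≤z))))

    combine : ∀ {s} → Der M A s ⊎ (x ≤ s × (Der M A (s *) → Der M A (x *))) →
              Der M A (s *) ⊎ (x ≤ s * × (Der M A (s * *) → Der M A (x *))) →
              Refutable M A ⊎ Der M A (x *)
    combine (inj₁ e) (inj₁ e*) = inj₁ (_ , e , e*)
    combine (inj₂ (_ , f)) (inj₁ e*) = inj₂ (f e*)
    combine (inj₁ e) (inj₂ (_ , f)) = inj₂ (f (subst (Der M A) (sym (*-involutive _)) e))
    combine (inj₂ (x≤s , _)) (inj₂ (x≤s* , _)) = ⊥-elim (x≰x* (≤-trans x≤s (*-swapʳ x≤s*)))

  -- Every separation in a derivation of x * lies below x *, so it can be met
  -- with s * once joining with s keeps the elements above x inside M.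
  shift : ∀ {M A x s} → (∀ {u} → M u → M (u *)) → DownClosedIn M A →
          (∀ {u} → M u → x ≤ u → M (s ∨ u)) →
          ∀ {z} → z ≤ x * → Der M A z → Der M A (z ∧ s *)
  shift {M} {A} {x} {s} closed down emulates = go
    where
    member : ∀ {z} → z ≤ x * → M z → M (z ∧ s *)
    -- `z ∧ s *` is the inverse of `s ∨ z *`, and `z *` lies above `x`.
    member {z} z≤x* Mz = subst M
      (trans (∨-* s (z *)) (trans (cong (s * ∧_) (*-involutive z)) (∧-comm _ _)))
      (closed (emulates (closed Mz) (*-swapʳ z≤x*)))

    go : ∀ {z} → z ≤ x * → Der M A z → Der M A (z ∧ s *)
    go z≤x* (hyp Mz Az) = hyp (member z≤x* Mz) (down Az (member z≤x* Mz) (x∧y≤x _ _))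
    go z≤x* (leaf Mz z≤z*) = leaf (member z≤x* Mz)
      (≤-trans (x∧y≤x _ _) (≤-trans z≤z* (*-antitone (x∧y≤x _ _))))
    go {z} z≤x* (node {x = a} {b} Mz da db a≤b* a≤z b≤z cs) = node (member z≤x* Mz)
      (go (≤-trans a≤z z≤x*) da) (go (≤-trans b≤z z≤x*) db)
      (≤-trans (x∧y≤x _ _) (≤-trans a≤b* (*-antitone (x∧y≤x _ _))))
      (∧-monotonic a≤z ≤-refl) (∧-monotonic b≤z ≤-refl)
      -- The inverse of `z ∧ s *` lies above both `z *` and `s`, so the new join contains everything
      -- that meeting with `s *` could lose.
      (CoSmall-restrict (s *)
        (∨∨-∧-≤ in₁ in₂ (≤-trans (x∧y≤x _ _) (≤-trans (*-antitone (x∧y≤x _ _)) in₃)))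
        (≤-trans (*-antitone (x∧y≤y _ _)) in₃) cs)

  -- Case distinction in a submodular system covered by a finite list

  module FinitelyCovered
    (em : ExcludedMiddle ℓ) (M : Pred Carrier ℓ) (closed : ∀ {s} → M s → M (s *))
    (submodular : ∀ {s t} → M s → M t → M (s ∨ t) ⊎ M (s ∧ t))
    (elements : List Carrier) (cover : ∀ {s} → M s → s ∈ˡ elements)
    where

    -- Provides the separation onto which two trees are shifted from opposite sides. It is a maximal
    -- one between `r` and `q` with the join property, which `r` itself has; maximality forces the
    -- meet property.
    separable : ∀ {r q} → M r → M q → r ≤ q →
                ∃[ s ] M s × r ≤ s × s ≤ q × (∀ {u} → M u → r ≤ u → M (s ∨ u))
                                           × (∀ {t} → M t → t ≤ q → M (s ∧ t))
    separable {r} {q} Mr Mq r≤q = result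
      where
      Emulates : Pred Carrier ℓ
      Emulates s = M s × r ≤ s × s ≤ q × (∀ {u} → M u → r ≤ u → M (s ∨ u))

      -- A minimal t violating the second requirement gives the larger emulator
      -- s ∨ t: if s ∨ t ∨ u is not in M then t ∧ (s ∨ u) is, and it is violating too.
      result : ∃[ s ] M s × r ≤ s × s ≤ q × (∀ {u} → M u → r ≤ u → M (s ∨ u))
                                          × (∀ {t} → M t → t ≤ q → M (s ∧ t))
      result with minimal (IsLattice.isPartialOrder ∧-∨-isLattice) em Emulates elements (cover Mr)
                    (Mr , ≤-refl , r≤q , λ Mu r≤u → subst M (sym (x≤y⇒x∨y≈y r≤u)) Mu)
      ... | s , (Ms , r≤s , s≤q , emulates) , max = s , Ms , r≤s , s≤q , emulates , meets
        where
        meets : ∀ {t} → M t → t ≤ q → M (s ∧ t)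
        meets {t₀} Mt₀ t₀≤q with em {M (s ∧ t₀)}
        ... | yes ok = ok
        ... | no bad₀ with minimal isPartialOrder em (λ t → M t × t ≤ q × ¬ M (s ∧ t))
                             elements (cover Mt₀) (Mt₀ , t₀≤q , bad₀)
        ... | t , (Mt , t≤q , bad) , min with submodular Ms Mt
        ... | inj₂ ok = ⊥-elim (bad ok)
        -- Since `s ∨ t` has the join property too, maximality of `s` gives `t ≤ s`. Then `s ∧ t` is
        -- `t`, which lies in `M`.
        ... | inj₁ Ms∨t = ⊥-elim (bad (subst M (sym (y≤x⇒x∧y≈y t≤s)) Mt))
          where
          s∨t-emulates : ∀ {u} → M u → r ≤ u → M ((s ∨ t) ∨ u)
          s∨t-emulates {u} Mu r≤u with submodular Mt (emulates Mu r≤u)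
          ... | inj₁ ok = subst M (≤-antisym
            (∨-least in₂ (∨-least in₁ in₃))
            (∨-least₃ (≤-trans (x≤x∨y _ _) (y≤x∨y _ _)) (x≤x∨y _ _)
                      (≤-trans (y≤x∨y _ _) (y≤x∨y _ _)))) ok
          -- Minimality of `t` turns `t ∧ (s ∨ u)` into `t`, so `t ≤ s ∨ u` and the join
          -- `(s ∨ t) ∨ u` is just `s ∨ u`.
          ... | inj₂ Mt′ = subst M (≤-antisym
            (∨-least in₁ in₃)
            (∨-least₃ (x≤x∨y _ _) (subst (_≤ s ∨ u) t′≡t (x∧y≤y _ _)) (y≤x∨y _ _)))
            (emulates Mu r≤u)
            where
            t′≡t : t ∧ (s ∨ u) ≡ t
            t′≡t = min (cover Mt′)
              (Mt′ , ≤-trans (x∧y≤x _ _) t≤q , λ ok → bad (subst M (≤-antisym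
                (∧-monotonic ≤-refl (x∧y≤x _ _))
                (∧-greatest (x∧y≤x _ _)
                  (∧-greatest (x∧y≤y _ _) (≤-trans (x∧y≤x _ _) (x≤x∨y _ _))))) ok))
              (x∧y≤x _ _)

          t≤s : t ≤ s
          t≤s = subst (t ≤_)
            (max (cover Ms∨t)
              (Ms∨t , ≤-trans r≤s (x≤x∨y _ _) , ∨-least s≤q t≤q , s∨t-emulates)
              (x≤x∨y _ _))
            (y≤x∨y _ _)

    -- For a separating `s`, shifting turns the root label `x *` into `s *` and `y *` into `s * *`;
    -- the two trees are then glued along this edge.
    join-refutations : ∀ {A x y} → DownClosedIn M A → M x → M y → x ≤ y * →
                       Der M A (x *) → Der M A (y *) → Refutable M A
    join-refutations {A} {x} {y} down Mx My x≤y* dx dy with separable Mx (closed My) x≤y*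
    ... | s , Ms , x≤s , s≤y* , joins , meets =
      s * , subst (Der M A) (y≤x⇒x∧y≈y (*-antitone x≤s)) (shift closed down joins ≤-refl dx)
          , subst (Der M A) (y≤x⇒x∧y≈y (subst (_≤ y *) (sym (*-involutive s)) s≤y*))
              (shift closed down joins* ≤-refl dy)
      where
      -- The meet property of `s` is, under the involution, the join property of `s *` above `y`.
      joins* : ∀ {u} → M u → y ≤ u → M (s * ∨ u)
      joins* {u} Mu y≤u = subst M (trans (∧-* s (u *)) (cong (s * ∨_) (*-involutive u)))
        (closed (meets (closed Mu) (*-antitone y≤u)))

    down-∪ : ∀ {A x} → DownClosedIn M A → (∀ {y} → M y → ¬ A y → y ≤ x → y ≡ x) →
             DownClosedIn M (A ∪ ｛ x ｝)
    down-∪ down min (inj₁ Aa) Mb b≤a = inj₁ (down Aa Mb b≤a)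
    down-∪ {A} down min {b = b} (inj₂ refl) Mb b≤x with em {A b}
    ... | yes Ab = inj₁ Ab
    ... | no ¬Ab = inj₂ (sym (min Mb ¬Ab b≤x))

    -- The elements x, minimal below r outside A, for r = s and r = s *, have
    -- down-closed A ∪ ｛ x ｝; induction makes both x * derivable from A.
    refute-cases : ∀ {A s} → DownClosedIn M A →
                   Refutable M (A ∪ (_≤ s)) → Refutable M (A ∪ (_≤ s *)) → Refutable M A
    refute-cases {s = s} = go (length elements) elements ℕₚ.≤-refl (λ Mz _ → cover Mz)
      where
      module _ {A : Pred Carrier ℓ} (down : DownClosedIn M A)
               (refute-∪ : ∀ {x} → M x → ¬ A x → DownClosedIn M (A ∪ ｛ x ｝) →
                           Refutable M (A ∪ ｛ x ｝)) where

        derivable : ∀ r → Refutable M (A ∪ (_≤ r)) →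
                    Refutable M A ⊎ ∃[ x ] M x × x ≤ r × Der M A (x *)
        derivable r (z , d , d*) with em {∃[ x ] M x × ¬ A x × x ≤ r}
        ... | no none = inj₁ (z , Der-bind absorb d , Der-bind absorb d*)
          where
          absorb : ∀ {z} → M z → (A ∪ (_≤ r)) z → Der M A z
          absorb Mz (inj₁ Az) = hyp Mz Az
          absorb {z} Mz (inj₂ z≤r) with em {A z}
          ... | yes Az = hyp Mz Az
          ... | no ¬Az = ⊥-elim (none (z , Mz , ¬Az , z≤r))
        ... | yes (x₀ , Mx₀ , ¬Ax₀ , x₀≤r)
          with minimal isPartialOrder em (λ x → M x × ¬ A x × x ≤ r) elements (cover Mx₀)
                 (Mx₀ , ¬Ax₀ , x₀≤r)
        ... | x , (Mx , ¬Ax , x≤r) , min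
          with reroot em closed (refute-∪ Mx ¬Ax (down-∪ down (λ My ¬Ay y≤x →
                 min (cover My) (My , ¬Ay , ≤-trans y≤x x≤r) y≤x)))
        ... | inj₁ refutation = inj₁ refutation
        ... | inj₂ dx* = inj₂ (x , Mx , x≤r , dx*)

        combine : Refutable M (A ∪ (_≤ s)) → Refutable M (A ∪ (_≤ s *)) → Refutable M A
        combine R R* with derivable s R | derivable (s *) R*
        ... | inj₁ refutation | _ = refutation
        ... | inj₂ _ | inj₁ refutation = refutation
        ... | inj₂ (x , Mx , x≤s , dx) | inj₂ (y , My , y≤s* , dy) =
          join-refutations down Mx My (≤-trans x≤s (*-swapʳ y≤s*)) dx dy

      -- The induction is on the length of a list containing all of `M` outside `A`; adding `x` to
      -- `A` removes `x` from it. When the list is empty, no `x` outside `A` remains to be treated.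
      go : ∀ n (todo : List Carrier) → length todo ℕ.≤ n → ∀ {A} →
           (∀ {z} → M z → ¬ A z → z ∈ˡ todo) → DownClosedIn M A →
           Refutable M (A ∪ (_≤ s)) → Refutable M (A ∪ (_≤ s *)) → Refutable M A
      go zero [] _ rest down = combine down λ Mx ¬Ax _ → contradiction (rest Mx ¬Ax) λ ()
      go (suc n) todo len {A} rest down R R* = combine down
        (λ {x} Mx ¬Ax down′ → go n (filter (≢? x) todo)
          (ℕₚ.≤-pred (ℕₚ.≤-trans (filter-notAll (≢? x) todo
            (Any.map (λ { refl x≢x → x≢x refl }) (rest Mx ¬Ax))) len))
          (λ Mz ¬A∪z → ∈-filter⁺ (≢? x) (rest Mz (¬A∪z ∘ inj₁)) (λ z≡x → ¬A∪z (inj₂ (sym z≡x))))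
          down′
          (Refutable-mono (widen (_≤ s)) R) (Refutable-mono (widen (_≤ s *)) R*))
        R R*
        where
        ≢? : ∀ x z → Dec (z ≢ x)
        ≢? x z = ¬? em

        widen : ∀ {x} (B : Pred Carrier ℓ) → A ∪ B ⊆ (A ∪ ｛ x ｝) ∪ B
        widen B (inj₁ Az) = inj₁ (inj₁ Az)
        widen B (inj₂ Bz) = inj₂ Bz

  -- Reduction to finite sublattices

  -- `X` collects the finitely many separations used. Quantifying over all larger lists lets several
  -- derivations be placed in one common list.
  restrict : ∀ {M A : Pred Carrier ℓ} {s} → Der M A s →
             ∃[ X ] (∀ L → (∀ {z} → z ∈ˡ X → z ∈ˡ L) → Der (M ∩ (_∈ˡ L)) A s)
  restrict {s = s} (hyp Ms As) = s ∷ [] , λ L X⊆L → hyp (Ms , X⊆L (here refl)) As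
  restrict {s = s} (leaf Ms s≤s*) = s ∷ [] , λ L X⊆L → leaf (Ms , X⊆L (here refl)) s≤s*
  restrict {s = s} (node Ms dx dy p q r c) with restrict dx | restrict dy
  ... | X , fx | Y , fy = s ∷ X ++ Y , λ L X⊆L →
    node (Ms , X⊆L (here refl)) (fx L (X⊆L ∘ there ∘ ∈-++⁺ˡ))
      (fy L (X⊆L ∘ there ∘ ∈-++⁺ʳ X)) p q r c

  unrestrict : ∀ {M N A : Pred Carrier ℓ} → Der (M ∩ N) A ⊆ Der M A
  unrestrict (hyp Ms As) = hyp (proj₁ Ms) As
  unrestrict (leaf Ms s≤s*) = leaf (proj₁ Ms) s≤s*
  unrestrict (node Ms dx dy p q r c) = node (proj₁ Ms) (unrestrict dx) (unrestrict dy) p q r c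

  record IsSublattice (L : List Carrier) : Set ℓ where
    field
      ∨-closed : ∀ {x y} → x ∈ˡ L → y ∈ˡ L → x ∨ y ∈ˡ L
      ∧-closed : ∀ {x y} → x ∈ˡ L → y ∈ˡ L → x ∧ y ∈ˡ L

  open IsSublattice

  -- The normal form of a lattice polynomial in `g` with coefficients in a distributive lattice.
  combination : Carrier → Carrier → Carrier → Carrier
  combination g a b = a ∨ (b ∧ g)

  adjoin : Carrier → List Carrier → List Carrier
  adjoin g L = cartesianProductWith (combination g) L L

  adjoin-sublattice : ∀ g {L} → IsSublattice L → IsSublattice (adjoin g L)
  adjoin-sublattice g {L} sub = record { ∨-closed = joins ; ∧-closed = meets }
    where
    joins : ∀ {x y} → x ∈ˡ adjoin g L → y ∈ˡ adjoin g L → x ∨ y ∈ˡ adjoin g L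
    joins x∈ y∈ with ∈-cartesianProductWith⁻ (combination g) L L x∈
                   | ∈-cartesianProductWith⁻ (combination g) L L y∈
    ... | a , b , a∈ , b∈ , refl | c , d , c∈ , d∈ , refl = subst (_∈ˡ adjoin g L)
      (≤-antisym
        (∨-least (∨-monotonic (x≤x∨y _ _) (x≤x∨y _ _))
          (≤-trans (≤-reflexive (∧-distribʳ-∨ g b d)) (∨-monotonic (y≤x∨y _ _) (y≤x∨y _ _))))
        (∨-least (∨-monotonic (x≤x∨y _ _) (∧-monotonic (x≤x∨y _ _) ≤-refl))
                 (∨-monotonic (y≤x∨y _ _) (∧-monotonic (y≤x∨y _ _) ≤-refl))))
      (∈-cartesianProductWith⁺ (combination g) (∨-closed sub a∈ c∈) (∨-closed sub b∈ d∈))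

    -- Expanding the meet gives constant part `a ∧ c` and, as coefficient of `g`, the join of
    -- `a ∧ d`, `b ∧ c` and `b ∧ d`.
    meets : ∀ {x y} → x ∈ˡ adjoin g L → y ∈ˡ adjoin g L → x ∧ y ∈ˡ adjoin g L
    meets x∈ y∈ with ∈-cartesianProductWith⁻ (combination g) L L x∈
                   | ∈-cartesianProductWith⁻ (combination g) L L y∈
    ... | a , b , a∈ , b∈ , refl | c , d , c∈ , d∈ , refl = subst (_∈ˡ adjoin g L)
      (≤-antisym
        (∨-least (∧-monotonic (x≤x∨y _ _) (x≤x∨y _ _))
          (≤-trans (≤-reflexive (∧-distribʳ-∨ g _ _)) (∨-least
            (≤-trans (≤-reflexive (∧-distribʳ-∨ g _ _)) (∨-least
              (∧-greatest (≤-trans (x∧y≤x _ _) (≤-trans (x∧y≤x _ _) (x≤x∨y _ _)))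
                          (≤-trans (∧-monotonic (x∧y≤y _ _) ≤-refl) (y≤x∨y _ _)))
              (∧-greatest (≤-trans (∧-monotonic (x∧y≤x _ _) ≤-refl) (y≤x∨y _ _))
                          (≤-trans (x∧y≤x _ _) (≤-trans (x∧y≤y _ _) (x≤x∨y _ _))))))
            (∧-greatest (≤-trans (∧-monotonic (x∧y≤x _ _) ≤-refl) (y≤x∨y _ _))
                        (≤-trans (∧-monotonic (x∧y≤y _ _) ≤-refl) (y≤x∨y _ _))))))
        (≤-trans (≤-reflexive (∧-distribʳ-∨ _ a (b ∧ g))) (∨-least
          (≤-trans (≤-reflexive (∧-distribˡ-∨ a c (d ∧ g))) (∨-least (x≤x∨y _ _)
            (≤-trans (∧-greatest (∧-monotonic ≤-refl (x∧y≤x _ _)) (≤-trans (x∧y≤y _ _) (x∧y≤y _ _)))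
              (≤-trans (∧-monotonic in₁ ≤-refl) (y≤x∨y _ _)))))
          (≤-trans (≤-reflexive (∧-distribˡ-∨ (b ∧ g) c (d ∧ g))) (∨-least
            (≤-trans (∧-greatest (∧-monotonic (x∧y≤x _ _) ≤-refl) (≤-trans (x∧y≤x _ _) (x∧y≤y _ _)))
              (≤-trans (∧-monotonic in₂ ≤-refl) (y≤x∨y _ _)))
            (≤-trans (∧-greatest (∧-monotonic (x∧y≤x _ _) (x∧y≤x _ _))
                                 (≤-trans (x∧y≤x _ _) (x∧y≤y _ _)))
              (≤-trans (∧-monotonic in₃ ≤-refl) (y≤x∨y _ _))))))))
      (∈-cartesianProductWith⁺ (combination g) (∧-closed sub a∈ c∈)
        (∨-closed sub (∨-closed sub (∧-closed sub a∈ d∈) (∧-closed sub b∈ c∈))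
                      (∧-closed sub b∈ d∈)))

  adjoin-⊇ : ∀ {g L x} → x ∈ˡ L → x ∈ˡ adjoin g L
  adjoin-⊇ {g} {L} {x} x∈ =
    subst (_∈ˡ adjoin g L) (∨-absorbs-∧ x _) (∈-cartesianProductWith⁺ (combination g) x∈ x∈)

  adjoin-∋ : ∀ {g L a b} → a ∈ˡ L → b ∈ˡ L → a ≤ g → g ≤ b → g ∈ˡ adjoin g L
  adjoin-∋ {g} {L} a∈ b∈ a≤g g≤b = subst (_∈ˡ adjoin g L)
    (≤-antisym (∨-least a≤g (x∧y≤y _ _)) (≤-trans (∧-greatest g≤b ≤-refl) (y≤x∨y _ _)))
    (∈-cartesianProductWith⁺ (combination g) a∈ b∈)

  -- By De Morgan the inverse of a combination is `a * ∧ (b * ∨ g *)`, a lattice word in elements of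
  -- `K`.
  adjoin-* : ∀ {g L K} → IsSublattice K → (∀ {x} → x ∈ˡ L → x * ∈ˡ K) → g * ∈ˡ K →
             ∀ {x} → x ∈ˡ adjoin g L → x * ∈ˡ K
  adjoin-* {g} {L} {K} sub L*⊆K g*∈K x∈ with ∈-cartesianProductWith⁻ (combination g) L L x∈
  ... | a , b , a∈ , b∈ , refl = subst (_∈ˡ K)
    (sym (trans (∨-* a (b ∧ g)) (cong (a * ∧_) (∧-* b g))))
    (∧-closed sub (L*⊆K a∈) (∨-closed sub (L*⊆K b∈) g*∈K))

  -- ⊤ₓ and ⊤ₓ * bound everything generated, which replaces the bounds U may lack.
  generate : ∀ (X : List Carrier) →
             ∃[ L ] IsSublattice L × (∀ {x} → x ∈ˡ L → x * ∈ˡ L) × (∀ {x} → x ∈ˡ X → x ∈ˡ L)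
  generate [] = [] , record { ∨-closed = λ () ; ∧-closed = λ () } , (λ ()) , λ ()
  generate X@(c ∷ _) with go X (λ x∈ → x∈)
    where
    bound : List Carrier → Carrier
    -- The head of `X` stands in for an empty join; it is bounded anyway, being in `X`.
    bound [] = c
    bound (x ∷ xs) = (x ∨ x *) ∨ bound xs

    ⊤ₓ : Carrier
    ⊤ₓ = bound X

    below : ∀ xs {x} → x ∈ˡ xs → x ≤ bound xs × x * ≤ bound xs
    below (x ∷ xs) (here refl) = in₁ , in₂
    below (x ∷ xs) (there x∈) =
      ≤-trans (proj₁ (below xs x∈)) (y≤x∨y _ _) , ≤-trans (proj₂ (below xs x∈)) (y≤x∨y _ _)

    bottom : ⊤ₓ * ≤ ⊤ₓ
    bottom = ≤-trans (*-antitone (proj₁ (below X (here refl)))) (proj₂ (below X (here refl)))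

    go : ∀ Y → (∀ {x} → x ∈ˡ Y → x ∈ˡ X) →
         ∃[ L ] IsSublattice L × (∀ {x} → x ∈ˡ L → x * ∈ˡ L) × (∀ {x} → x ∈ˡ Y → x ∈ˡ L)
                × ⊤ₓ ∈ˡ L × ⊤ₓ * ∈ˡ L
    go [] _ = ⊤ₓ ∷ ⊤ₓ * ∷ []
      , record
        { ∨-closed = λ
          { (here refl) y∈ → here (trans (∨-comm _ _) (x≤y⇒x∨y≈y (≤⊤ y∈)))
          ; (there (here refl)) y∈ → subst (_∈ˡ _) (sym (x≤y⇒x∨y≈y (⊥≤ y∈))) y∈ }
        ; ∧-closed = λ
          { (here refl) y∈ → subst (_∈ˡ _) (sym (y≤x⇒x∧y≈y (≤⊤ y∈))) y∈
          ; (there (here refl)) y∈ → there (here (trans (∧-comm _ _) (y≤x⇒x∧y≈y (⊥≤ y∈)))) } }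
      , (λ { (here refl) → there (here refl) ; (there (here refl)) → here (*-involutive ⊤ₓ) })
      , (λ ()) , here refl , there (here refl)
      where
      ≤⊤ : ∀ {y} → y ∈ˡ ⊤ₓ ∷ ⊤ₓ * ∷ [] → y ≤ ⊤ₓ
      ≤⊤ (here refl) = ≤-refl
      ≤⊤ (there (here refl)) = bottom

      ⊥≤ : ∀ {y} → y ∈ˡ ⊤ₓ ∷ ⊤ₓ * ∷ [] → ⊤ₓ * ≤ y
      ⊥≤ (here refl) = bottom
      ⊥≤ (there (here refl)) = ≤-refl
    go (g ∷ Y) Y⊆X with go Y (Y⊆X ∘ there)
    ... | L , sub , star , Y⊆L , ⊤∈ , ⊥∈ =
      K , subK
      , adjoin-* subK (adjoin-* subK (adjoin-⊇ ∘ adjoin-⊇ ∘ star)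
                        (subst (_∈ˡ K) (sym (*-involutive g)) g∈)) (adjoin-⊇ g*∈)
      , (λ { (here refl) → g∈ ; (there x∈) → adjoin-⊇ (adjoin-⊇ (Y⊆L x∈)) })
      , adjoin-⊇ (adjoin-⊇ ⊤∈) , adjoin-⊇ (adjoin-⊇ ⊥∈)
      where
      K : List Carrier
      -- Both orientations are adjoined, so that the inverses of all combinations can be formed
      -- inside `K`.
      K = adjoin g (adjoin (g *) L)

      subK : IsSublattice K
      subK = adjoin-sublattice g (adjoin-sublattice (g *) sub)

      g≤⊤ : g ≤ ⊤ₓ
      g≤⊤ = proj₁ (below X (Y⊆X (here refl)))

      g*≤⊤ : g * ≤ ⊤ₓ
      g*≤⊤ = proj₂ (below X (Y⊆X (here refl)))

      g*∈ : g * ∈ˡ adjoin (g *) L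
      g*∈ = adjoin-∋ ⊥∈ ⊤∈ (*-antitone g≤⊤) g*≤⊤

      g∈ : g ∈ˡ K
      g∈ = adjoin-∋ (adjoin-⊇ ⊥∈) (adjoin-⊇ ⊤∈) (*-swapˡ g*≤⊤) g≤⊤
  ... | L , sub , star , X⊆L , _ = L , sub , star , X⊆L


-- Zorn's lemma for families of subsets

module Subsets (em : ExcludedMiddle ℓ) (ext : Extensionality ℓ ℓ) where

  -- With values in `Bool`, subsets and families of subsets stay in `Set ℓ`, where excluded middle
  -- applies.
  Subset : Set ℓ → Set ℓ
  Subset C = C → Bool

  ⟦_⟧ : {C : Set ℓ} → Subset C → Pred C ℓ
  ⟦ A ⟧ x = Lift ℓ (T (A x))

  χ : {C : Set ℓ} → Pred C ℓ → Subset C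
  χ P x = isYes (em {P x})

  χ⁺ : ∀ {C : Set ℓ} (P : Pred C ℓ) → P ⊆ ⟦ χ P ⟧
  χ⁺ P Px = lift (fromWitness Px)

  χ⁻ : ∀ {C : Set ℓ} (P : Pred C ℓ) → ⟦ χ P ⟧ ⊆ P
  χ⁻ P (lift t) = toWitness t

  ⊆-antisym : ∀ {C : Set ℓ} {A B : Subset C} → ⟦ A ⟧ ⊆ ⟦ B ⟧ → ⟦ B ⟧ ⊆ ⟦ A ⟧ → A ≡ B
  ⊆-antisym {A = A} {B} A⊆B B⊆A =
    lower-extensionality ℓ ℓ ext λ x →
      bool (A x) (B x) (λ t → lower (A⊆B {x} (lift t))) (λ t → lower (B⊆A {x} (lift t)))
    where
    bool : ∀ a b → (T a → T b) → (T b → T a) → a ≡ b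
    bool true true _ _ = refl
    bool true false f _ = ⊥-elim (f tt)
    bool false true _ f = ⊥-elim (f tt)
    bool false false _ _ = refl

  module _ {C : Set ℓ} where

    Covered : Subset (Subset C) → Pred C ℓ
    Covered F x = ∃[ A ] ⟦ F ⟧ A × ⟦ A ⟧ x

    ⋃ : Subset (Subset C) → Subset C
    ⋃ F = χ (Covered F)

    ⊆-⋃ : ∀ {F A} → ⟦ F ⟧ A → ⟦ A ⟧ ⊆ ⟦ ⋃ F ⟧
    ⊆-⋃ {F} {A} FA Ax = χ⁺ (Covered F) (A , FA , Ax)

    ⋃-⊆ : ∀ {F B} → (∀ {A} → ⟦ F ⟧ A → ⟦ A ⟧ ⊆ ⟦ B ⟧) → ⟦ ⋃ F ⟧ ⊆ ⟦ B ⟧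
    ⋃-⊆ {F} F⊆B x∈ with χ⁻ (Covered F) x∈
    ... | A , FA , Ax = F⊆B FA Ax

    IsChain : Subset (Subset C) → Set ℓ
    IsChain F = ∀ {A B} → ⟦ F ⟧ A → ⟦ F ⟧ B → ⟦ A ⟧ ⊆ ⟦ B ⟧ ⊎ ⟦ B ⟧ ⊆ ⟦ A ⟧

    module _ (g : Subset C → Subset C) (inflationary : ∀ A → ⟦ A ⟧ ⊆ ⟦ g A ⟧) where

      -- The tower of the Bourbaki-Witt argument. Its bottom, the empty set, is the union of the
      -- empty family.
      data Tower : Pred (Subset C) ℓ where
        step  : ∀ {A} → Tower A → Tower (g A)
        union : ∀ F → (∀ {A} → ⟦ F ⟧ A → Tower A) → Tower (⋃ F)

      -- The extreme points of the Bourbaki-Witt argument: a step from strictly inside `A` does not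
      -- leave `A`.
      Extreme : Pred (Subset C) ℓ
      Extreme A = ∀ {B} → Tower B → ⟦ B ⟧ ⊆ ⟦ A ⟧ → ¬ (⟦ A ⟧ ⊆ ⟦ B ⟧) → ⟦ g B ⟧ ⊆ ⟦ A ⟧

      g-cong-⊆ : ∀ {A B} → ⟦ A ⟧ ⊆ ⟦ B ⟧ → ⟦ B ⟧ ⊆ ⟦ A ⟧ → ⟦ g A ⟧ ⊆ ⟦ g B ⟧
      g-cong-⊆ A⊆B B⊆A {x} = subst (λ D → ⟦ g D ⟧ x) (⊆-antisym A⊆B B⊆A)

      -- Induction on the tower element `B`. A step from strictly inside `A` stays inside because
      -- `A` is extreme; a union either lies in `A` or has a member outside, which already contains
      -- `g A`.
      extreme-compare : ∀ {A B} → Extreme A → Tower B → ⟦ B ⟧ ⊆ ⟦ A ⟧ ⊎ ⟦ g A ⟧ ⊆ ⟦ B ⟧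
      extreme-compare {A} ex (step {B} tB) with extreme-compare ex tB
      ... | inj₂ gA⊆B = inj₂ (inflationary B ∘ gA⊆B)
      ... | inj₁ B⊆A with em {⟦ A ⟧ ⊆ ⟦ B ⟧}
      ... | yes A⊆B = inj₂ (g-cong-⊆ A⊆B B⊆A)
      ... | no A⊈B = inj₁ (ex tB B⊆A A⊈B)
      extreme-compare {A} ex (union F ts) with em {∃[ B ] ⟦ F ⟧ B × ¬ (⟦ B ⟧ ⊆ ⟦ A ⟧)}
      ... | no none = inj₁ (⋃-⊆ {F} {A} λ {B} FB {x} Bx → below FB x Bx)
        where
        below : ∀ {B} → ⟦ F ⟧ B → ∀ x → ⟦ B ⟧ x → ⟦ A ⟧ x
        below {B} FB x Bx with em {⟦ B ⟧ ⊆ ⟦ A ⟧}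
        ... | yes B⊆A = B⊆A Bx
        ... | no B⊈A = ⊥-elim (none (B , FB , B⊈A))
      ... | yes (B , FB , B⊈A) with extreme-compare ex (ts FB)
      ... | inj₁ B⊆A = ⊥-elim (B⊈A B⊆A)
      ... | inj₂ gA⊆B = inj₂ (⊆-⋃ {F} FB ∘ gA⊆B)

      -- Induction on `A`. For a union, some member contains `B`, as otherwise the union would lie
      -- in `B`. That member is extreme, which settles strict inclusion; if it equals `B`, it is
      -- compared with the union itself.
      extreme : ∀ {A} → Tower A → Extreme A
      extreme (step {A} tA) {B} tB B⊆gA gA⊈B with extreme-compare (extreme tA) tB
      ... | inj₂ gA⊆B = ⊥-elim (gA⊈B gA⊆B)
      ... | inj₁ B⊆A with em {⟦ A ⟧ ⊆ ⟦ B ⟧}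
      ... | yes A⊆B = g-cong-⊆ B⊆A A⊆B
      ... | no A⊈B = inflationary A ∘ extreme tA tB B⊆A A⊈B
      extreme (union F ts) {B} tB B⊆⋃ ⋃⊈B with em {∃[ A ] ⟦ F ⟧ A × ⟦ B ⟧ ⊆ ⟦ A ⟧}
      ... | no none = ⊥-elim (⋃⊈B (⋃-⊆ {F} {B} λ {A} FA {x} Ax → below FA x Ax))
        where
        below : ∀ {A} → ⟦ F ⟧ A → ∀ x → ⟦ A ⟧ x → ⟦ B ⟧ x
        below {A} FA x Ax with extreme-compare (extreme (ts FA)) tB
        ... | inj₁ B⊆A = ⊥-elim (none (A , FA , B⊆A))
        ... | inj₂ gA⊆B = gA⊆B (inflationary A Ax)
      ... | yes (A , FA , B⊆A) with em {⟦ A ⟧ ⊆ ⟦ B ⟧}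
      ... | no A⊈B = ⊆-⋃ {F} FA ∘ extreme (ts FA) tB B⊆A A⊈B
      ... | yes A⊆B with extreme-compare (extreme (ts FA)) (union F ts)
      ... | inj₁ ⋃⊆A = ⊥-elim (⋃⊈B (A⊆B ∘ ⋃⊆A))
      ... | inj₂ gA⊆⋃ = gA⊆⋃ ∘ g-cong-⊆ B⊆A A⊆B

      tower-chain : ∀ {A B} → Tower A → Tower B → ⟦ A ⟧ ⊆ ⟦ B ⟧ ⊎ ⟦ B ⟧ ⊆ ⟦ A ⟧
      tower-chain {B = B} tA tB with extreme-compare (extreme tB) tA
      ... | inj₁ A⊆B = inj₁ A⊆B
      ... | inj₂ gB⊆A = inj₂ (gB⊆A ∘ inflationary B)

      fixpoint : ∃[ A ] Tower A × ⟦ g A ⟧ ⊆ ⟦ A ⟧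
      -- The union of the whole tower belongs to the tower, hence contains its own image under `g`.
      fixpoint = ⋃ (χ Tower) , tower , ⊆-⋃ {χ Tower} (χ⁺ Tower (step tower))
        where
        tower : Tower (⋃ (χ Tower))
        tower = union (χ Tower) (χ⁻ Tower)

    -- `grow` passes to a strictly larger set in `P` whenever there is one, so a fixed point is
    -- maximal. Deciding the type `Larger A` also supplies the choice of that set.
    zorn : (P : Pred (Subset C) ℓ) →
           (∀ F → IsChain F → (∀ {A} → ⟦ F ⟧ A → P A) → P (⋃ F)) →
           ∃[ A ] P A × (∀ {B} → P B → ⟦ A ⟧ ⊆ ⟦ B ⟧ → ⟦ B ⟧ ⊆ ⟦ A ⟧)
    zorn P P-⋃ = let A , tA , gA⊆A = fixpoint grow inflationary in A , tower-P tA , maximal A gA⊆A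
      where
      Larger : Subset C → Set ℓ
      Larger A = ∃[ B ] P B × ⟦ A ⟧ ⊆ ⟦ B ⟧ × ¬ (⟦ B ⟧ ⊆ ⟦ A ⟧)

      grow′ : ∀ A → Dec (Larger A) → Subset C
      grow′ A (yes (B , _)) = B
      grow′ A (no _) = A

      grow : Subset C → Subset C
      grow A = grow′ A em

      inflationary : ∀ A → ⟦ A ⟧ ⊆ ⟦ grow A ⟧
      inflationary A with em {Larger A}
      ... | yes (B , _ , A⊆B , _) = A⊆B
      ... | no _ = id

      grow-P : ∀ {A} → P A → P (grow A)
      grow-P {A} PA with em {Larger A}
      ... | yes (B , PB , _) = PB
      ... | no _ = PA

      tower-P : ∀ {A} → Tower grow inflationary A → P A
      tower-P (step tA) = grow-P (tower-P tA)
      tower-P (union F ts) = P-⋃ F (λ FA FB → tower-chain grow inflationary (ts FA) (ts FB))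
                               (λ FA → tower-P (ts FA))

      maximal : ∀ A → ⟦ grow A ⟧ ⊆ ⟦ A ⟧ → ∀ {B} → P B → ⟦ A ⟧ ⊆ ⟦ B ⟧ → ⟦ B ⟧ ⊆ ⟦ A ⟧
      maximal A gA⊆A {B} PB A⊆B with em {Larger A} | em {⟦ B ⟧ ⊆ ⟦ A ⟧}
      ... | _ | yes B⊆A = B⊆A
      ... | yes (D , _ , _ , D⊈A) | no _ = ⊥-elim (D⊈A gA⊆A)
      ... | no none | no B⊈A = ⊥-elim (none (B , PB , A⊆B , B⊈A))


-- From irrefutability to an abstract tangle

module Duality
  (em : ExcludedMiddle ℓ) (ext : Extensionality ℓ ℓ)
  (U : Universe ℓ) (distributive : Distributive U)
  (S : SeparationSystem U) (submodular : Submodular S)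
  where
  open DistributiveUniverse U distributive
  open SeparationSystem S
  open Subsets em ext

  -- Restricted to a finite sublattice closed under the involution, the system stays submodular,
  -- since joins and meets remain in the list.
  refute-cases : ∀ {A s} → DownClosedIn Member A →
                 Refutable Member (A ∪ (_≤ s)) → Refutable Member (A ∪ (_≤ s *)) →
                 Refutable Member A
  refute-cases {A} {s} down (x , d , d*) (y , e , e*)
    with restrict d | restrict d* | restrict e | restrict e*
  ... | X , d′ | X* , d*′ | Y , e′ | Y* , e*′ with generate ((X ++ X*) ++ (Y ++ Y*))
  ... | L , sub , star , ⊆L =
    let z , c , c* = FinitelyCovered.refute-cases em (Member ∩ (_∈ˡ L))
          (λ (Ms , s∈) → *-closed Ms , star s∈) submodular′ L proj₂ down′
          (x , d′ L (⊆L ∘ ∈-++⁺ˡ ∘ ∈-++⁺ˡ) , d*′ L (⊆L ∘ ∈-++⁺ˡ ∘ ∈-++⁺ʳ X))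
          (y , e′ L (⊆L ∘ ∈-++⁺ʳ (X ++ X*) ∘ ∈-++⁺ˡ) , e*′ L (⊆L ∘ ∈-++⁺ʳ (X ++ X*) ∘ ∈-++⁺ʳ Y))
    in z , unrestrict c , unrestrict c*
    where
    submodular′ : ∀ {s t} → (Member ∩ (_∈ˡ L)) s → (Member ∩ (_∈ˡ L)) t →
                  (Member ∩ (_∈ˡ L)) (s ∨ t) ⊎ (Member ∩ (_∈ˡ L)) (s ∧ t)
    submodular′ (Ms , s∈) (Mt , t∈) with submodular Ms Mt
    ... | inj₁ Ms∨t = inj₁ (Ms∨t , IsSublattice.∨-closed sub s∈ t∈)
    ... | inj₂ Ms∧t = inj₂ (Ms∧t , IsSublattice.∧-closed sub s∈ t∈)

    down′ : DownClosedIn (Member ∩ (_∈ˡ L)) A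
    down′ Aa (Mb , _) = down Aa Mb

  -- Submodularity of `r` and `s *` lets `r` be cut down to `r ∧ s *` or `s` to `s ∧ r *`. What is
  -- cut off lies below the other separation, which remains in the join, so co-smallness survives.
  uncross : ∀ {r s} → Member r → Member s →
            ∃[ r′ ] ∃[ s′ ] Member r′ × Member s′ × r′ ≤ r × s′ ≤ s × r′ ≤ s′ * ×
              (∀ {t} → CoSmall (r ∨ s ∨ t) → CoSmall (r′ ∨ s′ ∨ t))
  uncross {r} {s} Mr Ms with submodular Mr (*-closed Ms)
  ... | inj₂ Mr∧s* = r ∧ s * , s , Mr∧s* , Ms , x∧y≤x _ _ , ≤-refl , x∧y≤y _ _ ,
    CoSmall-restrict (s *) (∨∨-∧-≤ in₁ (≤-trans (x∧y≤x _ _) in₂) (≤-trans (x∧y≤x _ _) in₃))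
      (≤-trans (≤-reflexive (*-involutive s)) in₂)
  ... | inj₁ Mr∨s* = r , s ∧ r * , Mr
    , subst Member (trans (∨-* r (s *)) (trans (cong (r * ∧_) (*-involutive s)) (∧-comm _ _)))
        (*-closed Mr∨s*)
    , ≤-refl , x∧y≤x _ _ , *-swapʳ (x∧y≤y _ _) ,
    CoSmall-restrict (r *) (∨∨-∧-≤ (≤-trans (x∧y≤x _ _) in₁) in₂ (≤-trans (x∧y≤x _ _) in₃))
      (≤-trans (≤-reflexive (*-involutive r)) in₁)

  -- The three pairs are uncrossed in cyclic order; later shrinking preserves the star inequalities
  -- obtained before. The resulting star is a node whose cut edge is closed by the hypothesis `t₃`.
  refute-coSmall : ∀ {A r s t} → DownClosedIn Member A →
                   Member r → Member s → Member t → A r → A s → A t →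
                   CoSmall (r ∨ s ∨ t) → Refutable Member A
  refute-coSmall {A} down Mr Ms Mt Ar As At cs with uncross Mr Ms
  ... | r₁ , s₁ , Mr₁ , Ms₁ , r₁≤r , s₁≤s , r₁≤s₁* , cs₁ with uncross Ms₁ Mt
  ... | s₂ , t₂ , Ms₂ , Mt₂ , s₂≤s₁ , t₂≤t , s₂≤t₂* , cs₂ with uncross Mt₂ Mr₁
  ... | t₃ , r₃ , Mt₃ , Mr₃ , t₃≤t₂ , r₃≤r₁ , t₃≤r₃* , cs₃ =
    t₃ , hyp Mt₃ (down At Mt₃ (≤-trans t₃≤t₂ t₂≤t))
       , node (*-closed Mt₃)
           (hyp Mr₃ (down Ar Mr₃ (≤-trans r₃≤r₁ r₁≤r)))
           (hyp Ms₂ (down As Ms₂ (≤-trans s₂≤s₁ s₁≤s)))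
           (≤-trans r₃≤r₁ (≤-trans r₁≤s₁* (*-antitone s₂≤s₁)))
           (*-swapʳ t₃≤r₃*) (≤-trans s₂≤t₂* (*-antitone t₃≤t₂))
           (CoSmall-mono (∨-least₃ (≤-trans (≤-reflexive (sym (*-involutive _))) in₃) in₁ in₂)
             (cs₃ (CoSmall-rotate (cs₂ (CoSmall-rotate (cs₁ cs))))))

  ∅ₗ : Pred Carrier ℓ
  ∅ₗ _ = Lift ℓ ⊥

  irrefutable⇒tangle : ¬ Refutable Member ∅ₗ → HasAbstractTangle S
  irrefutable⇒tangle irrefutable with zorn Closed closed-⋃
    where
    Closed : Subset Carrier → Set ℓ
    Closed A = DownClosedIn Member ⟦ A ⟧ × ¬ Refutable Member ⟦ A ⟧

    closed-⋃ : ∀ F → IsChain F → (∀ {A} → ⟦ F ⟧ A → Closed A) → Closed (⋃ F)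
    closed-⋃ F chain closed = down , consistent
      where
      down : DownClosedIn Member ⟦ ⋃ F ⟧
      down ⋃a Mb b≤a with χ⁻ (Covered F) ⋃a
      ... | A , FA , Aa = ⊆-⋃ {F = F} FA (proj₁ (closed FA) Aa Mb b≤a)

      -- The empty set is added so that the chain is inhabited.
      members : Maybe (∃ ⟦ F ⟧) → Pred Carrier ℓ
      members nothing = ∅ₗ
      members (just (A , _)) = ⟦ A ⟧

      members-chain : ∀ i j → members i ⊆ members j ⊎ members j ⊆ members i
      members-chain nothing _ = inj₁ λ ()
      members-chain (just _) nothing = inj₂ λ ()
      members-chain (just (_ , FA)) (just (_ , FB)) = chain FA FB

      locate : ∀ {s} → Der Member ⟦ ⋃ F ⟧ s → ∃[ i ] Der Member (members i) s
      locate d = Der-directed members members-chain nothing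
        (Der-mono (λ ⋃s → let A , FA , As = χ⁻ (Covered F) ⋃s in just (A , FA) , As) d)

      irrefutable-members : ∀ i → ¬ Refutable Member (members i)
      irrefutable-members nothing = irrefutable
      irrefutable-members (just (_ , FA)) = proj₂ (closed FA)

      consistent : ¬ Refutable Member ⟦ ⋃ F ⟧
      consistent (s , d , d*) with locate d | locate d*
      ... | i , e | j , e* with members-chain i j
      ... | inj₁ i⊆j = irrefutable-members j (s , Der-mono i⊆j e , e*)
      ... | inj₂ j⊆i = irrefutable-members i (s , e , Der-mono j⊆i e*)
  ... | A , (down , consistent) , maximal = O , record
    { isOrientation = proj₁ , unique-orientation
    ; isConsistent = λ Mr _ _ r≤s (_ , As) (Mr* , Ar*) → both (Mr , down As Mr r≤s) (Mr* , Ar*)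
    ; avoids-𝒯 = λ { σ σ⊆O (r , s , t , (_ , ⊆σ) , cs) →
        let Mr , Ar = σ⊆O (⊆σ (inj₁ refl))
            Ms , As = σ⊆O (⊆σ (inj₂ (inj₁ refl)))
            Mt , At = σ⊆O (⊆σ (inj₂ (inj₂ refl)))
        in consistent (refute-coSmall down Mr Ms Mt Ar As At cs) }
    }
    where
    O : Pred Carrier ℓ
    O = Member ∩ ⟦ A ⟧

    both : ∀ {s} → s ∈ O → ¬ (s * ∈ O)
    both {s} (Ms , As) (Ms* , As*) = consistent (s , hyp Ms As , hyp Ms* As*)

    -- If adding everything below `s` leaves the set irrefutable, maximality of `A` puts `s` into
    -- `A`.
    refutable-or-∈ : ∀ {s} → Member s → Refutable Member (⟦ A ⟧ ∪ (_≤ s)) ⊎ ⟦ A ⟧ s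
    refutable-or-∈ {s} Ms with em {Refutable Member (⟦ A ⟧ ∪ (_≤ s))}
    ... | yes refutable = inj₁ refutable
    ... | no irrefutable′ = inj₂ (maximal {χ (⟦ A ⟧ ∪ (_≤ s))}
      ( (λ B₁ Mb b≤a → χ⁺ (⟦ A ⟧ ∪ (_≤ s)) (down-∪≤ (χ⁻ (⟦ A ⟧ ∪ (_≤ s)) B₁) Mb b≤a))
      , irrefutable′ ∘ Refutable-mono (χ⁻ (⟦ A ⟧ ∪ (_≤ s))))
      (χ⁺ (⟦ A ⟧ ∪ (_≤ s)) ∘ inj₁) (χ⁺ (⟦ A ⟧ ∪ (_≤ s)) (inj₂ ≤-refl)))
      where
      down-∪≤ : DownClosedIn Member (⟦ A ⟧ ∪ (_≤ s))
      down-∪≤ (inj₁ Aa) Mb b≤a = inj₁ (down Aa Mb b≤a)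
      down-∪≤ (inj₂ a≤s) _ b≤a = inj₂ (≤-trans b≤a a≤s)

    oriented : ∀ {s} → Member s → ⟦ A ⟧ s ⊎ ⟦ A ⟧ (s *)
    oriented Ms with refutable-or-∈ Ms | refutable-or-∈ (*-closed Ms)
    ... | inj₂ As | _ = inj₁ As
    ... | inj₁ _ | inj₂ As* = inj₂ As*
    ... | inj₁ R | inj₁ R* = ⊥-elim (consistent (refute-cases down R R*))

    unique-orientation : ∀ {s} → Member s →
      ∃[ y ] (sep s ∩ O) y × (∀ {z} → (sep s ∩ O) z → y ≡ z)
    unique-orientation {s} Ms with oriented Ms
    ... | inj₁ As = s , (inj₁ refl , Ms , As) , λ
      { (inj₁ s≡z , _) → s≡z ; (inj₂ refl , Os*) → ⊥-elim (both (Ms , As) Os*) }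
    ... | inj₂ As* = s * , (inj₂ refl , *-closed Ms , As*) , λ
      { (inj₁ refl , Os) → ⊥-elim (both Os (*-closed Ms , As*)) ; (inj₂ s*≡z , _) → s*≡z }


-- From refutations to labelled trees

module TreeOfDerivation
  (em : ExcludedMiddle ℓ) (U : Universe ℓ) (distributive : Distributive U)
  (S : SeparationSystem U) (nondegenerate : NoDegenerateElements S)
  where
  open DistributiveUniverse U distributive
  open SeparationSystem S

  -- graft makes the root of its last argument a child of the root of its first,
  -- along an edge whose orientation towards the parent is labelled s.
  data Tree : Set ℓ where
    point : Tree
    graft : Tree → ∀ {s} → Member s → Tree → Tree

  Node : Tree → Set
  Node point = ⊤
  Node (graft t _ b) = Node t ⊎ Node b

  root : ∀ t → Node t
  root point = tt
  root (graft t _ b) = inj₁ (root t)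

  -- A relation that includes the label `u` of the orientation from the first node to the second, so
  -- that adjacency and labelling are given together.
  Edge : ∀ t → Node t → Node t → Pred Carrier ℓ
  Edge point _ _ _ = Lift ℓ ⊥
  Edge (graft t _ b) (inj₁ p) (inj₁ q) u = Edge t p q u
  Edge (graft t _ b) (inj₂ p) (inj₂ q) u = Edge b p q u
  Edge (graft t {s} _ b) (inj₂ p) (inj₁ q) u = p ≡ root b × q ≡ root t × u ≡ s
  Edge (graft t {s} _ b) (inj₁ p) (inj₂ q) u = p ≡ root t × q ≡ root b × u ≡ s *

  Edge-Member : ∀ t p q {u} → Edge t p q u → Member u
  Edge-Member (graft t _ b) (inj₁ p) (inj₁ q) e = Edge-Member t p q e
  Edge-Member (graft t _ b) (inj₂ p) (inj₂ q) e = Edge-Member b p q e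
  Edge-Member (graft t Ms b) (inj₂ p) (inj₁ q) (_ , _ , refl) = Ms
  Edge-Member (graft t Ms b) (inj₁ p) (inj₂ q) (_ , _ , refl) = *-closed Ms

  Edge-sym : ∀ t p q {u} → Edge t p q u → Edge t q p (u *)
  Edge-sym (graft t _ b) (inj₁ p) (inj₁ q) e = Edge-sym t p q e
  Edge-sym (graft t _ b) (inj₂ p) (inj₂ q) e = Edge-sym b p q e
  Edge-sym (graft t _ b) (inj₂ p) (inj₁ q) (p≡ , q≡ , refl) = q≡ , p≡ , refl
  Edge-sym (graft t _ b) (inj₁ p) (inj₂ q) (p≡ , q≡ , refl) = q≡ , p≡ , *-involutive _

  Edge-label : ∀ t p q {u v} → Edge t p q u → Edge t p q v → u ≡ v
  Edge-label (graft t _ b) (inj₁ p) (inj₁ q) e f = Edge-label t p q e f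
  Edge-label (graft t _ b) (inj₂ p) (inj₂ q) e f = Edge-label b p q e f
  Edge-label (graft t _ b) (inj₂ p) (inj₁ q) (_ , _ , refl) (_ , _ , refl) = refl
  Edge-label (graft t _ b) (inj₁ p) (inj₂ q) (_ , _ , refl) (_ , _ , refl) = refl

  depth : ∀ t → Node t → ℕ
  depth point _ = 0
  depth (graft t _ b) (inj₁ p) = depth t p
  depth (graft t _ b) (inj₂ p) = suc (depth b p)

  depth-root : ∀ t → depth t (root t) ≡ 0
  depth-root point = refl
  depth-root (graft t _ b) = depth-root t

  Edge-depth : ∀ t p q {u} → Edge t p q u → depth t p ≢ depth t q
  Edge-depth (graft t _ b) (inj₁ p) (inj₁ q) e = Edge-depth t p q e
  Edge-depth (graft t _ b) (inj₂ p) (inj₂ q) e = Edge-depth b p q e ∘ ℕₚ.suc-injective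
  Edge-depth (graft t _ b) (inj₂ p) (inj₁ q) (_ , refl , _) rewrite depth-root t = λ ()
  Edge-depth (graft t _ b) (inj₁ p) (inj₂ q) (refl , _ , _) rewrite depth-root t = λ ()

  root-minimal : ∀ t q {u} → Edge t (root t) q u → ¬ (depth t q ℕ.≤ depth t (root t))
  root-minimal t q e q≤ = Edge-depth t (root t) q e
    (ℕₚ.≤-antisym (subst (ℕ._≤ depth t q) (sym (depth-root t)) z≤n) q≤)

  -- Only the two roots meet the grafted edge. The root of `b` has its parent across it and, by
  -- `root-minimal`, none inside `b`; the root of `t` has no parent at all.
  parent-unique : ∀ t p q q′ {u u′} → Edge t p q u → Edge t p q′ u′ →
                  depth t q ℕ.≤ depth t p → depth t q′ ℕ.≤ depth t p → q ≡ q′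
  parent-unique (graft t _ b) (inj₁ p) (inj₁ q) (inj₁ q′) e f q≤ q′≤ =
    cong inj₁ (parent-unique t p q q′ e f q≤ q′≤)
  parent-unique (graft t _ b) (inj₂ p) (inj₂ q) (inj₂ q′) e f q≤ q′≤ =
    cong inj₂ (parent-unique b p q q′ e f (ℕₚ.≤-pred q≤) (ℕₚ.≤-pred q′≤))
  parent-unique (graft t _ b) (inj₂ p) (inj₁ q) (inj₁ q′) (_ , refl , _) (_ , refl , _) _ _ = refl
  parent-unique (graft t _ b) (inj₂ p) (inj₁ q) (inj₂ q′) (refl , _) f _ q′≤ =
    ⊥-elim (root-minimal b q′ f (ℕₚ.≤-pred q′≤))
  parent-unique (graft t _ b) (inj₂ p) (inj₂ q) (inj₁ q′) e (refl , _) q≤ _ =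
    ⊥-elim (root-minimal b q e (ℕₚ.≤-pred q≤))
  parent-unique (graft t _ b) (inj₁ p) (inj₂ q) _ (refl , _) _ q≤ _
    with depth t (root t) | depth-root t
  parent-unique (graft t _ b) (inj₁ p) (inj₂ q) _ (refl , _) _ () _ | _ | refl
  parent-unique (graft t _ b) (inj₁ p) (inj₁ q) (inj₂ q′) _ (refl , _) _ q′≤
    with depth t (root t) | depth-root t
  parent-unique (graft t _ b) (inj₁ p) (inj₁ q) (inj₂ q′) _ (refl , _) _ () | _ | refl

  Joined : ∀ t → Rel (Node t) ℓ
  Joined t p q = ∃[ u ] Edge t p q u

  to-root : ∀ t p → Star (Joined t) p (root t)
  to-root point tt = ε
  to-root (graft t _ b) (inj₁ p) = Star.gmap inj₁ id (to-root t p)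
  to-root (graft t Ms b) (inj₂ p) =
    Star.gmap inj₂ id (to-root b p) ◅◅ (_ , refl , refl , refl) ◅ ε

  size : Tree → ℕ
  size point = 1
  size (graft t _ b) = size t ℕ.+ size b

  numbering : ∀ t → Fin (size t) ↔ Node t
  numbering point = 1↔⊤
  numbering (graft t _ b) = (numbering t ⊎-↔ numbering b) ↔-∘ +↔⊎

  Near : ∀ t → Node t → Pred Carrier ℓ
  Near t p u = ∃[ q ] Edge t q p u

  𝒯*-resp-≐ : ∀ {σ τ} → σ ≐ τ → 𝒯* U σ → 𝒯* U τ
  𝒯*-resp-≐ (σ⊆τ , τ⊆σ) ((r , s , t , (σ⊆ , ⊆σ) , cs) , nondeg , star) =
    (r , s , t , (σ⊆ ∘ τ⊆σ , σ⊆τ ∘ ⊆σ) , cs) ,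
    nondeg ∘ τ⊆σ , λ s∈ t∈ → star (τ⊆σ s∈) (τ⊆σ t∈)

  -- The star at `p` in a tree with a cut edge at its root, where `s` is the label of that edge
  -- towards the root.
  WithRootEdge : ∀ t → Carrier → Node t → Pred Carrier ℓ
  WithRootEdge t s p = Near t p ∪ (λ u → p ≡ root t × u ≡ s)

  graft-old : ∀ t {s} (Ms : Member s) b p →
              WithRootEdge t s p ≐ Near (graft t Ms b) (inj₁ p)
  graft-old t Ms b p =
    (λ { (inj₁ (q , e)) → inj₁ q , e ; (inj₂ (p≡ , u≡)) → inj₂ (root b) , refl , p≡ , u≡ }) ,
    (λ { (inj₁ q , e) → inj₁ (q , e) ; (inj₂ q , _ , p≡ , u≡) → inj₂ (p≡ , u≡) })

  graft-new : ∀ t {s} (Ms : Member s) b p →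
              WithRootEdge b (s *) p ≐ Near (graft t Ms b) (inj₂ p)
  graft-new t Ms b p =
    (λ { (inj₁ (q , e)) → inj₂ q , e ; (inj₂ (p≡ , u≡)) → inj₁ (root t) , refl , p≡ , u≡ }) ,
    (λ { (inj₂ q , e) → inj₁ (q , e) ; (inj₁ q , _ , p≡ , u≡) → inj₂ (p≡ , u≡) })

  star₃ : ∀ {x y z} → Member x → Member y → Member z →
          x ≤ y * → x ≤ z * → y ≤ z * → CoSmall (x ∨ y ∨ z) → 𝒯* U (｛ x ｝ ∪ ｛ y ｝ ∪ ｛ z ｝)
  star₃ Mx My Mz x≤y* x≤z* y≤z* cs =
    (_ , _ , _ , (id , id) , cs) ,
    (λ { (inj₁ refl) → nondegenerate Mx
       ; (inj₂ (inj₁ refl)) → nondegenerate My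
       ; (inj₂ (inj₂ refl)) → nondegenerate Mz }) ,
    λ { (inj₁ refl) (inj₁ refl) s≢t → ⊥-elim (s≢t refl)
      ; (inj₁ refl) (inj₂ (inj₁ refl)) _ → x≤y*
      ; (inj₁ refl) (inj₂ (inj₂ refl)) _ → x≤z*
      ; (inj₂ (inj₁ refl)) (inj₁ refl) _ → *-swapʳ x≤y*
      ; (inj₂ (inj₁ refl)) (inj₂ (inj₁ refl)) s≢t → ⊥-elim (s≢t refl)
      ; (inj₂ (inj₁ refl)) (inj₂ (inj₂ refl)) _ → y≤z*
      ; (inj₂ (inj₂ refl)) (inj₁ refl) _ → *-swapʳ x≤z*
      ; (inj₂ (inj₂ refl)) (inj₂ (inj₁ refl)) _ → *-swapʳ y≤z*
      ; (inj₂ (inj₂ refl)) (inj₂ (inj₂ refl)) s≢t → ⊥-elim (s≢t refl) }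

  module _ {A : Pred Carrier ℓ} (none : ∀ {s} → ¬ A s) where

    -- The cut edge carries `s` outwards, hence `s *` towards the root. A `leaf` becomes a single
    -- point with star `s *`, a `node` a point with two trees grafted to it.
    tree : ∀ {s} → Der Member A s → ∃[ t ] (∀ p → 𝒯* U (WithRootEdge t (s *) p))
    tree (hyp _ As) = ⊥-elim (none As)
    tree {s} (leaf Ms s≤s*) = point , λ _ →
      ((s * , s * , s * , ((λ { (inj₂ (_ , refl)) → inj₁ refl })
        , (λ { (inj₁ refl) → inj₂ (refl , refl) ; (inj₂ (inj₁ refl)) → inj₂ (refl , refl)
             ; (inj₂ (inj₂ refl)) → inj₂ (refl , refl) }))
        , CoSmall-mono in₁ (≤-trans (≤-reflexive (*-involutive s)) s≤s*))
      , (λ { (inj₂ (_ , refl)) → nondegenerate (*-closed Ms) })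
      , (λ { (inj₂ (_ , refl)) (inj₂ (_ , refl)) s≢s → ⊥-elim (s≢s refl) }))
    tree {s} (node {x = x} {y} Ms dx dy x≤y* x≤s y≤s cs) =
      let tx , starsx = tree dx
          ty , starsy = tree dy
      in graft (graft point (Der⇒M dx) tx) (Der⇒M dy) ty , λ
      { (inj₁ (inj₁ tt)) → 𝒯*-resp-≐
          ( (λ { (inj₁ refl) → inj₁ (inj₁ (inj₂ (root tx)) , refl , refl , refl)
               ; (inj₂ (inj₁ refl)) → inj₁ (inj₂ (root ty) , refl , refl , refl)
               ; (inj₂ (inj₂ refl)) → inj₂ (refl , refl) })
          , (λ { (inj₁ (inj₁ (inj₂ _) , _ , _ , refl)) → inj₁ refl
               ; (inj₁ (inj₂ _ , _ , _ , refl)) → inj₂ (inj₁ refl)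
               ; (inj₂ (_ , refl)) → inj₂ (inj₂ refl) }))
          (star₃ (Der⇒M dx) (Der⇒M dy) (*-closed Ms) x≤y*
            (subst (x ≤_) (sym (*-involutive s)) x≤s) (subst (y ≤_) (sym (*-involutive s)) y≤s) cs)
      ; (inj₁ (inj₂ p)) → 𝒯*-resp-≐
          ( (λ n → let q , e = proj₁ (graft-new point (Der⇒M dx) tx p) n in inj₁ (inj₁ q , e))
          , (λ { (inj₁ (inj₁ q , e)) → proj₂ (graft-new point (Der⇒M dx) tx p) (q , e)
               ; (inj₁ (inj₂ _ , _ , () , _))
               ; (inj₂ (() , _)) }))
          (starsx p)
      ; (inj₂ p) → 𝒯*-resp-≐
          ( (λ n → inj₁ (proj₁ (graft-new (graft point (Der⇒M dx) tx) (Der⇒M dy) ty p) n))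
          , (λ { (inj₁ n) → proj₂ (graft-new (graft point (Der⇒M dx) tx) (Der⇒M dy) ty p) n
               ; (inj₂ (() , _)) }))
          (starsy p) }

    -- The cut edges of the two trees carry inverse labels, so one graft identifies them and
    -- completes both root stars.
    closedTree : Refutable Member A → ∃[ t ] (∀ p → 𝒯* U (Near t p))
    closedTree (s , d , d*) =
      let t , stars = tree d
          b , stars* = tree d*
      in graft t (Der⇒M d*) b , λ
      { (inj₁ p) → 𝒯*-resp-≐ (graft-old t (Der⇒M d*) b p) (stars p)
      ; (inj₂ p) → 𝒯*-resp-≐ (graft-new t (Der⇒M d*) b p) (stars* p) }

  -- The finite graph of a labelled tree and its S-tree

  cycle-neighbours : ∀ {a r k} {V : Set a} {R : Rel V r} (c : Fin (3 ℕ.+ k) → V) →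
                     (∀ {x y} → R x y → R y x) →
                     (∀ i → R (c (inject₁ i)) (c (suc i))) → R (c (fromℕ (2 ℕ.+ k))) (c zero) →
                     ∀ m → ∃[ i ] ∃[ j ] i ≢ j × R (c m) (c i) × R (c m) (c j)
  cycle-neighbours c R-sym steps close zero = suc zero , fromℕ _ , (λ ()) , steps zero , R-sym close
  cycle-neighbours c R-sym steps close (suc i) with view i
  ... | ‵fromℕ = zero , inject₁ (fromℕ _) , (λ ()) , close , R-sym (steps (fromℕ _))
  ... | ‵inj₁ {i = j} _ = suc (suc j) , inject₁ (inject₁ j) , distinct , steps (suc j) ,
    R-sym (steps (inject₁ j))
    where
    distinct : suc (suc j) ≢ inject₁ (inject₁ j)
    distinct eq = ℕₚ.m≢1+n+m (toℕ j) {1}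
      (sym (trans (cong toℕ eq) (trans (toℕ-inject₁ (inject₁ j)) (toℕ-inject₁ j))))

  argmax : ∀ {n} (f : Fin (suc n) → ℕ) → ∃[ m ] (∀ i → f i ℕ.≤ f m)
  argmax {zero} f = zero , λ { zero → ℕₚ.≤-refl }
  argmax {suc n} f with argmax (f ∘ suc)
  ... | m , max with ℕₚ.≤-total (f zero) (f (suc m))
  ... | inj₁ ≤m = suc m , λ { zero → ≤m ; (suc i) → max i }
  ... | inj₂ m≤ = zero , λ { zero → ℕₚ.≤-refl ; (suc i) → ℕₚ.≤-trans (max i) m≤ }

  module _ (t : Tree) where
    open Inverse (numbering t) using (to; from; strictlyInverseˡ; strictlyInverseʳ)

    graph : Graph
    graph = record
      { order = size t
      ; edge? = λ i j → isYes (em {Joined t (to i) (to j)})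
      ; symmetric = λ i j e → let u , f = toWitness e in fromWitness (u * , Edge-sym t _ _ f)
      ; irreflexive = λ i e → Edge-depth t _ _ (proj₂ (toWitness e)) refl
      }

    open Graph graph using (V; Adj; symmetric)

    joined : ∀ {i j} → Adj i j → Joined t (to i) (to j)
    joined = toWitness

    connected-root : ∀ p → Star Adj (from p) (from (root t))
    connected-root p = Star.gmap from
      (λ {x} {y} e → fromWitness
        (subst₂ (Joined t) (sym (strictlyInverseˡ x)) (sym (strictlyInverseˡ y)) e))
      (to-root t p)

    connected : ∀ i j → Star Adj i j
    connected i j = down i ◅◅ Star.reverse (λ {x} {y} → symmetric x y) (down j)
      where
      down : ∀ i → Star Adj i (from (root t))
      down i = subst (λ i → Star Adj i (from (root t))) (strictlyInverseʳ i) (connected-root (to i))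

    -- Both neighbours of a deepest vertex of a cycle would be its parent.
    acyclic : ∀ k c → ¬ IsCycle graph k c
    acyclic k c (injective , steps , close)
      with argmax (depth t ∘ to ∘ c)
    ... | m , max with cycle-neighbours {R = Adj} c (λ {x} {y} → symmetric x y) steps close m
    ... | i , j , i≢j , mi , mj = i≢j (injective (to-injective
      (parent-unique t _ _ _ (proj₂ (joined mi)) (proj₂ (joined mj)) (max i) (max j))))
      where
      to-injective : ∀ {i j} → to i ≡ to j → i ≡ j
      to-injective eq = trans (sym (strictlyInverseʳ _)) (trans (cong from eq) (strictlyInverseʳ _))

    sTree : STree S
    sTree = record
      { tree = graph
      ; isTree = record { nonEmpty = from (root t) ; connected = connected ; acyclic = acyclic }
      ; α = λ i j e → proj₁ (joined e)
      ; α-Member = λ i j e → Edge-Member t _ _ (proj₂ (joined e))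
      ; α-* = λ i j e e′ → Edge-label t _ _ (proj₂ (joined e′)) (Edge-sym t _ _ (proj₂ (joined e)))
      }

    sTreeOver : (∀ p → 𝒯* U (Near t p)) → STreeOver S (𝒯* U)
    sTreeOver stars = sTree , λ j → 𝒯*-resp-≐ (near-image j) (stars (to j))
      where
      near-image : ∀ j → Near t (to j) ≐ STree.α[F_] sTree j
      near-image j =
        (λ { (q , e) →
          let e′ = subst (λ q → Edge t q (to j) _) (sym (strictlyInverseˡ q)) e
              adj = fromWitness (_ , e′)
          in from q , adj , Edge-label t _ _ (proj₂ (joined adj)) e′ }) ,
        (λ { (i , e , refl) → to i , proj₂ (joined e) })


-- Walks in a finite tree

fold-repeat : ∀ {A : Set} (f : A → A) {a b} x → a ℕ.< b → fold x f a ≡ fold x f b →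
              ∃[ e ] e ℕ.< b × fold (fold x f a) f (suc e) ≡ fold x f a
fold-repeat f {a} {b} x a<b eq with ℕₚ.m≤n⇒∃[o]m+o≡n a<b
-- `e` is `b` minus `a` minus one, which makes the period `suc e` positive.
... | e , refl = e , s≤s (ℕₚ.m≤n+m e a) ,
  trans (sym (fold-+ x f (suc e))) (trans (cong (λ n → fold x f (suc n)) (ℕₚ.+-comm e a)) (sym eq))

module _ {G : Graph} (isTree : IsTree G) where
  open Graph G
  open IsTree isTree

  -- A shortest period of f would trace out a cycle.
  walk-turns-back : (f : V → V) → (∀ x → Adj x (f x)) → ¬ (∀ x → f (f x) ≢ x)
  walk-turns-back f step no-return with pigeonhole (ℕₚ.n<1+n order) (λ i → fold nonEmpty f (toℕ i))
  ... | i , j , i<j , eq = let e , _ , period = fold-repeat f nonEmpty i<j eq in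
    aperiodic e _ period
    where
    aperiodic : ∀ d x → fold x f (suc d) ≢ x
    -- The period is `suc d`: period one is a loop, period two turns back, and period `3 + k` traces
    -- a cycle unless two of its vertices coincide. Such a coincidence gives a shorter period from
    -- another starting vertex.
    aperiodic = <-rec _ λ
      { zero _ x fx≡x → irreflexive x (subst (Adj x) fx≡x (step x))
      ; (suc zero) _ x ffx≡x → no-return x ffx≡x
      ; (suc (suc k)) shorter x period →
        let distinct : ∀ {a b} → a ℕ.< b → b ℕ.< 3 ℕ.+ k → fold x f a ≢ fold x f b
            distinct a<b b<3+k eq = let e , e<b , eq′ = fold-repeat f x a<b eq in
              shorter (ℕₚ.≤-trans e<b (ℕₚ.≤-pred b<3+k)) _ eq′
        in acyclic k (λ i → fold x f (toℕ i))
          ( (λ {i} {j} eq → injective distinct i j eq)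
          , (λ i → subst (λ n → Adj (fold x f n) (f (fold x f (toℕ i))))
                     (sym (toℕ-inject₁ i)) (step _))
          , subst (λ n → Adj (fold x f n) x) (sym (toℕ-fromℕ (2 ℕ.+ k)))
              (subst (Adj _) period (step _))) }
      where
      injective : ∀ {k x} → (∀ {a b} → a ℕ.< b → b ℕ.< 3 ℕ.+ k → fold x f a ≢ fold x f b) →
                  ∀ (i j : Fin (3 ℕ.+ k)) → fold x f (toℕ i) ≡ fold x f (toℕ j) → i ≡ j
      injective distinct i j eq with ℕₚ.<-cmp (toℕ i) (toℕ j)
      ... | tri< i<j _ _ = ⊥-elim (distinct i<j (toℕ<n j) eq)
      ... | tri≈ _ i≡j _ = toℕ-injective i≡j
      ... | tri> _ _ j<i = ⊥-elim (distinct j<i (toℕ<n i) (sym eq))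

-- Tangles exclude S-trees

module _ (em : ExcludedMiddle ℓ) {U : Universe ℓ} (S : SeparationSystem U)
         (nondegenerate : NoDegenerateElements S) where
  open Universe U
  open SeparationSystem S

  tangle⇒¬tree : HasAbstractTangle S → ¬ STreeOver S (𝒯* U)
  tangle⇒¬tree (O , tangle) (sTree , over) = case (em {∃[ x ] ¬ Out x})
    where
    open IsAbstractTangle tangle
    open STree sTree

    opposite : ∀ {s} → Member s → O s → ¬ O (s *)
    opposite Ms Os Os* with proj₂ isOrientation Ms
    ... | y , _ , unique =
      nondegenerate Ms (trans (sym (unique (inj₁ refl , Os))) (unique (inj₂ refl , Os*)))

    reverse : ∀ {s} → Member s → ¬ O s → O (s *)
    reverse Ms ¬Os with proj₂ isOrientation Ms
    ... | _ , (inj₁ refl , Os) , _ = ⊥-elim (¬Os Os)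
    ... | _ , (inj₂ refl , Os*) , _ = Os*

    Out : V → Set ℓ
    Out x = ∃[ y ] Σ (Adj x y) λ e → O (α x y e)

    case : ¬ Dec (∃[ x ] ¬ Out x)
    -- No label leaving the sink is in `O`, so every label entering it is, and its star is a subset
    -- of `O` belonging to `𝒯`.
    case (yes (t , sink)) = avoids-𝒯 (α[F t ])
      (λ { (s , e , refl) → subst O (sym (α-* t s (symmetric s t e) e))
             (reverse (α-Member t s (symmetric s t e)) (λ Oα → sink (s , symmetric s t e , Oα))) })
      (proj₁ (over t))
    -- Without a sink, following outgoing edges gives a walk that never turns back, as doing so
    -- would put both orientations of an edge into `O`.
    case (no none) = walk-turns-back isTree (λ x → proj₁ (out x)) (λ x → proj₁ (proj₂ (out x)))
      λ x ffx≡x → returns x (out x) (out _) ffx≡x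
      where
      out : ∀ x → Out x
      out x with em {Out x}
      ... | yes o = o
      ... | no ¬o = ⊥-elim (none (x , ¬o))

      returns : ∀ x (o : Out x) (o′ : Out (proj₁ o)) → proj₁ o′ ≢ x
      returns x (y , e , Oe) (_ , e′ , Oe′) refl =
        opposite (α-Member x y e) Oe (subst O (α-* x y e e′) Oe′)

theorem2 : ∀ {ℓ} → ExcludedMiddle ℓ → Extensionality ℓ ℓ →
    (U : Universe ℓ) → Distributive U →
    (S : SeparationSystem U) → Submodular S → NoDegenerateElements S →
    (HasAbstractTangle S ⊎ STreeOver S (𝒯* U)) ×
    ¬ (HasAbstractTangle S × STreeOver S (𝒯* U))
theorem2 em ext U distributive S submodular nondegenerate =
  tangle-or-tree em , λ (tangle , tree) → tangle⇒¬tree em S nondegenerate tangle tree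
  where
  open Duality em ext U distributive S submodular
  open TreeOfDerivation em U distributive S nondegenerate
  open DistributiveUniverse U distributive using (Refutable)

  tangle-or-tree : Dec (Refutable (SeparationSystem.Member S) ∅ₗ) →
                   HasAbstractTangle S ⊎ STreeOver S (𝒯* U)
  tangle-or-tree (no irrefutable) = inj₁ (irrefutable⇒tangle irrefutable)
  tangle-or-tree (yes refutation) =
    let t , stars = closedTree (λ ()) refutation in inj₂ (sTreeOver t stars)
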